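{- Let $E$ be a finite set, let $\mathbb{I}=(S,(R_e)_{e\in E})$ be a finite $\mathsf{E}$-graph (the constraint graph), let $\mathbb{G}$ be a finite $\mathsf{E}$-group compatible with $\mathbb{I}$, and let $N\geq 2$. Then there is a finite $\mathsf{E}$-group $\hat{\mathbb{G}}\succeq\mathbb{G}$ that is compatible with $\mathbb{I}$ and $N$-acyclic over $\mathbb{I}$, and such that every permutation $\rho\in\mathrm{Sym}(E)$ that is a symmetry of $\mathbb{I}$ and of $\mathbb{G}$ is also a symmetry of $\hat{\mathbb{G}}$.
   Context: An $\mathsf{E}$-graph is $\mathbb{H}=(V,(R_e)_{e\in E})$ where each $R_e\subseteq V\times V$ is symmetric and every vertex has at most one $R_e$-neighbour (a loop counts as a neighbour). For $e\in E$ let $\pi_e\in\mathrm{Sym}(V)$ be the involution swapping the two ends of each $R_e$-edge and fixing all other vertices; for $w=e_1\cdots e_n\in E^*$ put $[w]_{\mathbb{H}}=\pi_{e_n}\circ\cdots\circ\pi_{e_1}$. An $\mathsf{E}$-group is a group $\mathbb{G}=(G,\cdot,1)$ containing $E$ as a set of pairwise distinct non-trivial involutions generating $\mathbb{G}$; $[w]_{\mathbb{G}}=e_1\cdots e_n$. For $\alpha\subseteq E$, $\mathbb{G}[\alpha]$ is the subgroup generated by $\alpha$. $\hat{\mathbb{G}}\succeq\mathbb{G}$ means there is a group homomorphism $\hat{\mathbb{G}}\to\mathbb{G}$ mapping each $e\in E$ to $e$. $\mathbb{G}$ is compatible with the $\mathsf{E}$-graph $\mathbb{H}$ if for all $w\in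 E^*$, $[w]_{\mathbb{G}}=1$ implies $[w]_{\mathbb{H}}=\mathrm{id}_V$. For $\alpha\subseteq E$ and $s,t\in S$, $\alpha^*[\mathbb{I},s]$ is the set of words $w=e_1\cdots e_n\in\alpha^*$ labelling a walk from $s$ in $\mathbb{I}$ (i.e. there are $s=s_0,s_1,\dots,s_n$ with $(s_{i-1},s_i)\in R_{e_i}$), and $\alpha^*[\mathbb{I},s,t]$ those whose walk ends in $t$. For $g\in G$, the $\mathbb{I}[\alpha,s]$-coset of $g$ is $\mathbb{G}[\mathbb{I},\alpha,s;g]:=\{g[w]_{\mathbb{G}}: w\in\alpha^*[\mathbb{I},s]\}$. An $\mathbb{I}$-coset cycle of length $n\ge 2$ in $\mathbb{G}$ is a cyclically indexed sequence $(\mathbb{G}[\mathbb{I},\alpha_i,s_i;g_i],g_i)_{i\in\mathbb{Z}_n}$ with $\alpha_i\subsetneq E$, $s_i\in S$, $g_i\in G$, such that for all $i$: (connectivity) $g_{i+1}=g_i[w]_{\mathbb{G}}$ for some $w\in\alpha_i^*[\mathbb{I},s_i,s_{i+1}]$; (separation) $\mathbb{G}[\mathbb{I},\alpha_i\cap\alpha_{i-1},s_i;g_i]\cap\mathbb{G}[\mathbb{I},\alpha_i\cap\alpha_{i+1},s_{i+1};g_{i+1}]=\emptyset$. An $\mathsf{E}$-group compatible with $\mathbb{I}$ is $N$-acyclic over $\mathbb{I}$ if it admits no $\mathbb{I}$-coset cycle of length at most $N$. A permutation $\rho$ of $E$ is a symmetry of the $\mathsf{E}$-group $\mathbb{G}$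 if there is a group automorphism $\varphi$ of $\mathbb{G}$ with $\varphi(e)=\rho(e)$ for all $e\in E$; it is a symmetry of the $\mathsf{E}$-graph $\mathbb{I}$ if there is a bijection $f\colon S\to S$ with $(s,t)\in R_e \Leftrightarrow (f(s),f(t))\in R_{\rho(e)}$ for all $s,t,e$. -}

module Defs where

open import Level using (Level; _⊔_; suc)
open import Data.Nat using (ℕ; _+_; _≤_; NonZero)
open import Data.Nat.DivMod using (_%_; m%n<n)
open import Data.Fin using (Fin; toℕ; fromℕ<)
open import Data.Fin.Subset using (Subset; _∈_; _∉_; _∩_)
open import Data.Fin.Permutation using (Permutation′; _⟨$⟩ʳ_)
open import Data.Maybe using (Maybe; just; nothing; fromMaybe)
open import Data.List using (List; []; _∷_)
open import Data.Product using (Σ; ∃; ∃-syntax; _×_; _,_)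
open import Relation.Nullary using (¬_)
open import Relation.Binary.PropositionalEquality using (_≡_)
open import Algebra.Bundles using (Group)
open import Algebra.Morphism.Structures using (module GroupMorphisms)
open import Function using (_⇔_)

-- E-graphs with E = Fin m and vertex set V = Fin n.
-- The relation R_e is encoded by the partial function nbr e:
-- (s , t) ∈ R_e  iff  nbr e s ≡ just t.  A partial function encodes
-- exactly "at most one R_e-neighbour"; `sym` is symmetry of R_e.

record EGraph (m n : ℕ) : Set where
  field
    nbr : Fin m → Fin n → Maybe (Fin n)
    sym : ∀ e s t → nbr e s ≡ just t → nbr e t ≡ just s

  R : Fin m → Fin n → Fin n → Set
  R e s t = nbr e s ≡ just t

  π : Fin m → Fin n → Fin n
  π e s = fromMaybe s (nbr e s)

  ⟦_⟧H : List (Fin m) → Fin n → Fin n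
  ⟦ [] ⟧H s = s
  ⟦ e ∷ w ⟧H s = ⟦ w ⟧H (π e s)

  data Walk (α : Subset m) : Fin n → List (Fin m) → Fin n → Set where
    nil  : ∀ {s} → Walk α s [] s
    cons : ∀ {e s s' w t} → e ∈ α → R e s s' → Walk α s' w t → Walk α s (e ∷ w) t

evalWord : ∀ {m c ℓ} (G : Group c ℓ) → (Fin m → Group.Carrier G) → List (Fin m) → Group.Carrier G
evalWord G ι [] = Group.ε G
evalWord G ι (e ∷ w) = Group._∙_ G (ι e) (evalWord G ι w)

record EGroup (m : ℕ) (c ℓ : Level) : Set (suc (c ⊔ ℓ)) where
  field
    group : Group c ℓ
  open Group group public
  field
    ι        : Fin m → Carrier
    invol    : ∀ e → ι e ∙ ι e ≈ ε
    nontriv  : ∀ e → ¬ (ι e ≈ ε)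
    distinct : ∀ e e' → ι e ≈ ι e' → e ≡ e'

    generates : ∀ g → ∃[ w ] (g ≈ evalWord group ι w)

  ⟦_⟧G : List (Fin m) → Carrier
  ⟦_⟧G = evalWord group ι

FiniteEGroup : ∀ {m c ℓ} → EGroup m c ℓ → Set (c ⊔ ℓ)
FiniteEGroup G = ∃[ k ] Σ (Fin k → Carrier) (λ f → ∀ g → ∃[ i ] (f i ≈ g))
  where open EGroup G

_⪰_ : ∀ {m c ℓ c' ℓ'} → EGroup m c ℓ → EGroup m c' ℓ' → Set (c ⊔ ℓ ⊔ c' ⊔ ℓ')
Ĝ ⪰ G = Σ (Ĝ.Carrier → G.Carrier) λ h →
          GroupMorphisms.IsGroupHomomorphism Ĝ.rawGroup G.rawGroup h
        × (∀ e → h (Ĝ.ι e) G.≈ G.ι e)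
  where module Ĝ = EGroup Ĝ
        module G = EGroup G

Compatible : ∀ {m n c ℓ} → EGroup m c ℓ → EGraph m n → Set ℓ
Compatible G H = ∀ w → ⟦ w ⟧G ≈ ε → ∀ s → ⟦ w ⟧H s ≡ s
  where open EGroup G
        open EGraph H

csuc : ∀ {k} .{{_ : NonZero k}} → Fin k → Fin k
csuc {k} i = fromℕ< (m%n<n (toℕ i + 1) k)

cpred : ∀ {k} .{{_ : NonZero k}} → Fin k → Fin k
cpred {k} i = fromℕ< (m%n<n (toℕ i + (k Data.Nat.∸ 1)) k)

module _ {m n c ℓ} (G : EGroup m c ℓ) (I : EGraph m n) where
  open EGroup G
  open EGraph I

  InCoset : Subset m → Fin n → Carrier → Carrier → Set ℓ
  InCoset α s g x = ∃[ w ] ∃[ t ] (Walk α s w t × x ≈ g ∙ ⟦ w ⟧G)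

  ProperSubset : Subset m → Set
  ProperSubset α = ∃[ e ] (e ∉ α)

  record CosetCycle (k : ℕ) .{{_ : NonZero k}} : Set (c ⊔ ℓ) where
    field
      α : Fin k → Subset m
      s : Fin k → Fin n
      g : Fin k → Carrier
      proper       : ∀ i → ProperSubset (α i)
      connectivity : ∀ i → ∃[ w ] (Walk (α i) (s i) w (s (csuc i))
                                   × g (csuc i) ≈ g i ∙ ⟦ w ⟧G)
      separation   : ∀ i → ¬ (∃[ x ]
                         (InCoset (α i ∩ α (cpred i)) (s i) (g i) x
                        × InCoset (α i ∩ α (csuc i)) (s (csuc i)) (g (csuc i)) x))

  Acyclic : ℕ → Set (c ⊔ ℓ)
  Acyclic N = Compatible G I
            × (∀ j → 2 + j ≤ N → ¬ CosetCycle (2 + j))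

GroupSymmetry : ∀ {m c ℓ} → EGroup m c ℓ → Permutation′ m → Set (c ⊔ ℓ)
GroupSymmetry G ρ = Σ (Carrier → Carrier) λ φ →
    GroupMorphisms.IsGroupIsomorphism rawGroup rawGroup φ
  × (∀ e → φ (ι e) ≈ ι (ρ ⟨$⟩ʳ e))
  where open EGroup G

GraphSymmetry : ∀ {m n} → EGraph m n → Permutation′ m → Set
GraphSymmetry {m} {n} I ρ = Σ (Permutation′ n) λ f →
  ∀ s t e → R e s t ⇔ R (ρ ⟨$⟩ʳ e) (f ⟨$⟩ʳ s) (f ⟨$⟩ʳ t)
  where open EGraph I

{-# OPTIONS --safe #-}
module Submission where

open import Defs
open import Level using (Level; Lift; lift; lower; 0ℓ) renaming (_⊔_ to _⊔ˡ_)
open import Data.Nat using (ℕ; zero; suc; _+_; _*_; _^_; _≤_; _<_; z≤n; s≤s)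
import Data.Nat.Properties as ℕₚ
open import Data.Nat.DivMod using (_%_; m%n<n; m%n%n≡m%n; n%n≡0; [m+n]%n≡m%n; %-distribˡ-+)
open import Data.Fin using (Fin; zero; suc; toℕ; fromℕ<; punchIn; punchOut; combine; remQuot; inject≤; finToFun; funToFin)
import Data.Fin.Properties as Finₚ
open import Data.Fin.Subset using (Subset; _∈_; _∉_; _∩_; _∪_; _⊆_; ∣_∣; ⊤; ⊥; ⁅_⁆; inside; outside)
import Data.Fin.Subset.Properties as Subₚ
open import Data.Fin.Permutation using (Permutation′; _⟨$⟩ʳ_; _⟨$⟩ˡ_)
import Data.Fin.Permutation as Perm
open import Data.Bool using (Bool; true; false; not; if_then_else_)
open import Data.Unit using (tt) renaming (⊤ to Unit)
open import Data.Empty using (⊥-elim) renaming (⊥ to Empty)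
open import Data.Maybe using (Maybe; just; nothing; fromMaybe)
import Data.Maybe
open import Data.List using (List; []; _∷_; _++_; length; filter; map; take; drop)
import Data.List.Properties as Listₚ
open import Data.List.Relation.Unary.All using (All; []; _∷_)
import Data.List.Relation.Unary.All as All
import Data.List.Relation.Unary.All.Properties as Allₚ
open import Data.Vec using (Vec; []; _∷_; lookup; here; there)
open import Data.Product using (Σ; ∃; ∃-syntax; _×_; _,_; proj₁; proj₂)
open import Data.Sum using (_⊎_; inj₁; inj₂)
open import Function using (_∘_; id; _$_; case_of_)
open import Relation.Nullary using (¬_; ¬?; Dec; yes; no)
open import Relation.Nullary.Decidable using (¬¬-excluded-middle; decidable-stable; ⌊_⌋; _×-dec_; does; dec-true; dec-false)
open import Relation.Binary.PropositionalEquality using (_≡_; refl; sym; trans; cong; subst)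
open import Algebra.Bundles using (Group)

-- Ĝ is a group of permutations that does not depend on the relations of G or I.  It is built in levels:
-- at level k + 1 words are compared by their actions in all permutation representations of bounded
-- degree in which every relation of level k between at most k letters holds.  Hence subgroups
-- generated by k letters do not change after level k, every permutation of the letters is a symmetry,
-- and the degree bounds can be chosen so large that G, I and the graphs below occur among the
-- representations.  A graph built from cosets of small subgroups qualifies as soon as each of its
-- β-components either is a complete coset (Free) or has fewer points than the bound for |β| (Bounded).
--
-- Gluing n cosets into a chain gives a representation which shows that a closed product of n elements
-- of small subgroups always has a side splitting into factors shared with its neighbours.  For walks
-- in I, the coset of all walks from s is completed by attaching the full coset of every proper
-- subgroup ⟨γ⟩ at each of its points.  In the completion a walk equal to a product of elements of
-- ⟨γ₁⟩, ⟨γ₂⟩, ⟨γ₃⟩ is seen to be a product of walks in γ₁, γ₂, γ₃.  Together the two facts exclude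
-- short coset cycles over I.  All these statements are negative, so the argument runs under double
-- negation and needs no decidability of the equality of G.

-- Deleting all letters outside β respects equality at every level, so ⟨β⟩ is a retract of the group
-- and ⟨β⟩ ∩ ⟨γ⟩ = ⟨β ∩ γ⟩. This handles closed products of two or three small elements; from four
-- on a chain is needed.
--
-- Each level has two bounds because chains and completions differ in size. A chain consists of at
-- most `N` cosets with representatives modulo `bd k`; `mid k` is large enough for it, so splittings
-- are available modulo `mid k`. The completion is glued with these splittings, hence modulo
-- `mid k`; its points are pairs of representatives, and `bd (suc k)` is large enough for those. The
-- price is that convexity at the next level first holds only modulo `mid k`. The error is a closed
-- product of four small elements, and such a product is trivial at every bound once it is trivial
-- at `mid k`.
--
-- Excluding coset cycles takes convexity for products of two factors. The third factor is there for
-- the induction: when a point of the completion is compared with a hub, the walk between their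
-- bases is a product of three elements, from the subgroup of the hub, from ⟨β⟩ and from the
-- subgroup of the point.

infixl 1 _>>=_

_>>=_ : ∀ {a b} {A : Set a} {B : Set b} → ¬ ¬ A → (A → ¬ ¬ B) → ¬ ¬ B
(x >>= f) ¬b = x (λ a → f a ¬b)

return : ∀ {a} {A : Set a} → A → ¬ ¬ A
return a ¬a = ¬a a

em : ∀ {a} {A : Set a} → ¬ ¬ Dec A
em = ¬¬-excluded-middle

¬¬-Fin : ∀ {n p} {P : Fin n → Set p} → (∀ i → ¬ ¬ P i) → ¬ ¬ (∀ i → P i)
¬¬-Fin {zero} f = return λ ()
¬¬-Fin {suc n} f = do
  p₀ ← f zero
  ps ← ¬¬-Fin (f ∘ suc)
  return λ { zero → p₀ ; (suc i) → ps i }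

-- Words over the generators and their actions

Word : ℕ → Set
Word m = List (Fin m)

Letters : ℕ → ℕ → Set
Letters m M = Fin m → Fin M → Fin M

module _ {m : ℕ} where

  infix 4 _⊑_
  _⊑_ : Word m → Subset m → Set
  w ⊑ β = All (_∈ β) w

  infixl 7 _↾_
  _↾_ : Word m → Subset m → Word m
  w ↾ β = filter (Subₚ._∈? β) w

  inv : Word m → Word m
  inv [] = []
  inv (e ∷ w) = inv w ++ e ∷ []

  inv-++ : ∀ u v → inv (u ++ v) ≡ inv v ++ inv u
  inv-++ [] v = sym (Listₚ.++-identityʳ _)
  inv-++ (e ∷ u) v = trans (cong (_++ e ∷ []) (inv-++ u v)) (Listₚ.++-assoc (inv v) (inv u) _)

  inv-inv : ∀ u → inv (inv u) ≡ u
  inv-inv [] = refl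
  inv-inv (e ∷ u) = trans (inv-++ (inv u) (e ∷ [])) (cong (e ∷_) (inv-inv u))

  ⊑-++ : ∀ {u v β} → u ⊑ β → v ⊑ β → u ++ v ⊑ β
  ⊑-++ = Allₚ.++⁺

  ⊑-inv : ∀ {u β} → u ⊑ β → inv u ⊑ β
  ⊑-inv [] = []
  ⊑-inv (p ∷ ps) = Allₚ.++⁺ (⊑-inv ps) (p ∷ [])

  ⊑-mono : ∀ {u β γ} → β ⊆ γ → u ⊑ β → u ⊑ γ
  ⊑-mono β⊆γ = All.map (λ e∈β → β⊆γ e∈β)

  ⊑-∩ : ∀ {u β γ} → u ⊑ β → u ⊑ γ → u ⊑ β ∩ γ
  ⊑-∩ [] [] = []
  ⊑-∩ (p ∷ ps) (q ∷ qs) = Subₚ.x∈p∩q⁺ (p , q) ∷ ⊑-∩ ps qs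

  ⊑-∩ˡ : ∀ {u β γ} → u ⊑ β ∩ γ → u ⊑ β
  ⊑-∩ˡ {β = β} {γ} = ⊑-mono (Subₚ.p∩q⊆p β γ)

  ⊑-∩ʳ : ∀ {u β γ} → u ⊑ β ∩ γ → u ⊑ γ
  ⊑-∩ʳ {β = β} {γ} = ⊑-mono (Subₚ.p∩q⊆q β γ)

  ⊑-⊤ : ∀ w → w ⊑ ⊤
  ⊑-⊤ [] = []
  ⊑-⊤ (e ∷ w) = Subₚ.∈⊤ ∷ ⊑-⊤ w

  ↾-⊑ : ∀ w β → w ↾ β ⊑ β
  ↾-⊑ w β = Allₚ.all-filter (Subₚ._∈? β) w

  ↾-keeps : ∀ {w γ} β → w ⊑ γ → w ↾ β ⊑ γ
  ↾-keeps β = Allₚ.filter⁺ (Subₚ._∈? β)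

  ↾-++ : ∀ u v β → (u ++ v) ↾ β ≡ u ↾ β ++ v ↾ β
  ↾-++ u v β = Listₚ.filter-++ (Subₚ._∈? β) u v

  ↾-id : ∀ {w β} → w ⊑ β → w ↾ β ≡ w
  ↾-id {β = β} = Listₚ.filter-all (Subₚ._∈? β)

  Small : ℕ → Word m → Set
  Small k w = ∃[ β ] (∣ β ∣ ≤ k × w ⊑ β)

  ⊈-witness : ∀ {β γ : Subset m} → ¬ (β ⊆ γ) → ∃[ a ] (a ∈ β × a ∉ γ)
  ⊈-witness {β} {γ} β⊈γ with Finₚ.any? (λ a → (a Subₚ.∈? β) ×-dec ¬? (a Subₚ.∈? γ))
  ... | yes p = p
  ... | no ¬p = ⊥-elim (β⊈γ λ {a} a∈β → decidable-stable (a Subₚ.∈? γ) λ a∉γ → ¬p (a , a∈β , a∉γ))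

  ∩-< : ∀ {β γ : Subset m} → ¬ (β ⊆ γ) → ∣ β ∩ γ ∣ < ∣ β ∣
  ∩-< {β} {γ} β⊈γ with ⊈-witness β⊈γ
  ... | a , a∈β , a∉γ = Subₚ.p⊂q⇒∣p∣<∣q∣
    (Subₚ.p∩q⊆p β γ , a , a∈β , λ a∈β∩γ → a∉γ (proj₂ (Subₚ.x∈p∩q⁻ β γ a∈β∩γ)))

  act : ∀ {M} → Letters m M → Word m → Fin M → Fin M
  act σ [] x = x
  act σ (e ∷ w) x = act σ w (σ e x)

  Involutive : ∀ {M} → Letters m M → Set
  Involutive σ = ∀ e x → σ e (σ e x) ≡ x

  act-++ : ∀ {M} (σ : Letters m M) u v x → act σ (u ++ v) x ≡ act σ v (act σ u x)
  act-++ σ [] v x = refl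
  act-++ σ (e ∷ u) v x = act-++ σ u v (σ e x)

  act-inv : ∀ {M} {σ : Letters m M} → Involutive σ → ∀ w x → act σ (inv w) (act σ w x) ≡ x
  act-inv {σ = σ} i [] x = refl
  act-inv {σ = σ} i (e ∷ w) x =
    trans (act-++ σ (inv w) (e ∷ []) _) (trans (cong (σ e) (act-inv i w (σ e x))) (i e x))

  act-inv′ : ∀ {M} {σ : Letters m M} → Involutive σ → ∀ w x → act σ w (act σ (inv w) x) ≡ x
  act-inv′ {σ = σ} i w x =
    subst (λ v → act σ v (act σ (inv w) x) ≡ x) (inv-inv w) (act-inv i (inv w) x)

  act-cong : ∀ {M} {σ τ : Letters m M} → (∀ e x → σ e x ≡ τ e x) → ∀ w x → act σ w x ≡ act τ w x
  act-cong p [] x = refl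
  act-cong {σ = σ} {τ} p (e ∷ w) x = trans (cong (act σ w) (p e x)) (act-cong p w (τ e x))

  restrictTo : ∀ {M} → Subset m → Letters m M → Letters m M
  restrictTo β σ e x = if ⌊ e Subₚ.∈? β ⌋ then σ e x else x

  restrictTo-involutive : ∀ {M} {σ : Letters m M} β → Involutive σ → Involutive (restrictTo β σ)
  restrictTo-involutive β i e x with e Subₚ.∈? β
  ... | yes _ = i e x
  ... | no _ = refl

  act-restrictTo : ∀ {M} (σ : Letters m M) β w x → act (restrictTo β σ) w x ≡ act σ (w ↾ β) x
  act-restrictTo σ β [] x = refl
  act-restrictTo σ β (e ∷ w) x with e Subₚ.∈? β
  ... | yes _ = act-restrictTo σ β w (σ e x)
  ... | no _ = act-restrictTo σ β w x

-- Representations by levels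

module Tower {m : ℕ} (bd : ℕ → ℕ) where

  -- Mutual recursion on the level: admissibility at level k + 1 consults level k at the fixed bound
  -- `bd k`. The bound of `SameAction` itself stays free, so that one level can be examined at
  -- several bounds.
  Admissible : ℕ → ∀ {M} → Letters m M → Set
  SameAction : ℕ → ℕ → Word m → Word m → Set

  Admissible zero σ = Unit
  Admissible (suc k) σ = ∀ w → Small k w → SameAction (bd k) k w [] → ∀ x → act σ w x ≡ x

  SameAction M k u v = ∀ M′ → M′ ≤ M → (σ : Letters m M′) → Involutive σ → Admissible k σ →
    ∀ x → act σ u x ≡ act σ v x

  -- `SameAction` unfolds to a function type; the record lets unification recover the bound, the
  -- level and the words.
  record Eq (M k : ℕ) (u v : Word m) : Set where
    constructor eq
    field sameAction : SameAction M k u v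
  open Eq public

  module _ {M k : ℕ} where

    Eq-refl : ∀ {u} → Eq M k u u
    Eq-refl = eq λ _ _ _ _ _ _ → refl

    Eq-sym : ∀ {u v} → Eq M k u v → Eq M k v u
    Eq-sym p = eq λ M′ l σ i a x → sym (sameAction p M′ l σ i a x)

    Eq-trans : ∀ {u v w} → Eq M k u v → Eq M k v w → Eq M k u w
    Eq-trans p q = eq λ M′ l σ i a x → trans (sameAction p M′ l σ i a x) (sameAction q M′ l σ i a x)

    Eq-reflexive : ∀ {u v} → u ≡ v → Eq M k u v
    Eq-reflexive refl = Eq-refl

    Eq-stable : ∀ {u v} → ¬ ¬ Eq M k u v → Eq M k u v
    Eq-stable p = eq λ M′ l σ i a x →
      decidable-stable (_ Finₚ.≟ _) (λ ¬q → p (λ q → ¬q (sameAction q M′ l σ i a x)))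

    Eq-++ : ∀ {u u′ v v′} → Eq M k u u′ → Eq M k v v′ → Eq M k (u ++ v) (u′ ++ v′)
    Eq-++ {u} {u′} {v} {v′} p q = eq λ M′ l σ i a x →
      trans (act-++ σ u v x) (trans (sameAction q M′ l σ i a _)
        (trans (cong (act σ v′) (sameAction p M′ l σ i a x)) (sym (act-++ σ u′ v′ x))))

    Eq-inv : ∀ {u v} → Eq M k u v → Eq M k (inv u) (inv v)
    Eq-inv {u} {v} p = eq λ M′ l σ i a x →
      trans (sym (cong (act σ (inv u)) (act-inv′ i v x)))
        (trans (cong (act σ (inv u)) (sym (sameAction p M′ l σ i a _))) (act-inv i u _))

    Eq-cancelʳ : ∀ u → Eq M k (u ++ inv u) []
    Eq-cancelʳ u = eq λ M′ l σ i a x → trans (act-++ σ u (inv u) x) (act-inv i u x)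

    Eq-cancelˡ : ∀ u → Eq M k (inv u ++ u) []
    Eq-cancelˡ u = eq λ M′ l σ i a x → trans (act-++ σ (inv u) u x) (act-inv′ i u x)

  Eq-group : ℕ → ℕ → Group 0ℓ 0ℓ
  Eq-group M k = record
    { Carrier = Word m ; _≈_ = Eq M k ; _∙_ = _++_ ; ε = [] ; _⁻¹ = inv
    ; isGroup = record
      { isMonoid = record
        { isSemigroup = record
          { isMagma = record
            { isEquivalence = record { refl = Eq-refl ; sym = Eq-sym ; trans = Eq-trans }
            ; ∙-cong = Eq-++ }
          ; assoc = λ u v w → Eq-reflexive (Listₚ.++-assoc u v w) }
        ; identity = (λ _ → Eq-refl) , (λ u → Eq-reflexive (Listₚ.++-identityʳ u)) }
      ; inverse = Eq-cancelˡ , Eq-cancelʳ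
      ; ⁻¹-cong = Eq-inv } }

  -- Mutual induction on the level. Deleting letters maps relations of small subgroups to such
  -- relations, so letting the letters outside β act as the identity keeps a representation
  -- admissible. Testing words in the representation so obtained shows that `_↾ β` is an
  -- endomorphism of the group, a retraction onto ⟨β⟩.
  admissible-restrictTo : ∀ k {M} {σ : Letters m M} β → Admissible k σ → Admissible k (restrictTo β σ)
  Eq-↾ : ∀ {M} k {u v} β → Eq M k u v → Eq M k (u ↾ β) (v ↾ β)

  admissible-restrictTo zero β a = tt
  admissible-restrictTo (suc k) {σ = σ} β a w (γ , γ≤k , w⊑γ) w≈ x =
    trans (act-restrictTo σ β w x)
      (a (w ↾ β) (γ , γ≤k , ↾-keeps β w⊑γ) (sameAction (Eq-↾ {bd k} k {w} {[]} β (eq w≈))) x)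

  Eq-↾ k {u} {v} β p = eq λ M′ l σ i a x →
    trans (sym (act-restrictTo σ β u x))
      (trans (sameAction p M′ l (restrictTo β σ) (restrictTo-involutive β i) (admissible-restrictTo k β a) x)
        (act-restrictTo σ β v x))

  Eq-≤ : ∀ {M M₁ k u v} → M₁ ≤ M → Eq M k u v → Eq M₁ k u v
  Eq-≤ l p = eq λ M′ l′ → sameAction p M′ (ℕₚ.≤-trans l′ l)

  -- The retraction onto ⟨β⟩ fixes `v`. For `u` over γ the word `u ↾ β` is over γ ∩ β, so this is
  -- ⟨γ⟩ ∩ ⟨β⟩ = ⟨γ ∩ β⟩ with an explicit representative.
  Eq-meet : ∀ {M k u v β} → Eq M k u v → v ⊑ β → Eq M k u (u ↾ β)
  Eq-meet {M} {k} {u} {v} {β} p v⊑β =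
    Eq-trans p (Eq-sym (subst (Eq M k (u ↾ β)) (↾-id v⊑β) (Eq-↾ k β p)))

  module Monotone (bd-mono : ∀ k → bd k ≤ bd (suc k)) where

    bd-≤ : ∀ {j k} → j ≤ k → bd j ≤ bd k
    bd-≤ {zero} {zero} z≤n = ℕₚ.≤-refl
    bd-≤ {zero} {suc k} z≤n = ℕₚ.≤-trans (bd-≤ {zero} {k} z≤n) (bd-mono k)
    bd-≤ {suc j} {suc k} (s≤s l) with ℕₚ.m≤n⇒m<n∨m≡n l
    ... | inj₁ j<k = ℕₚ.≤-trans (bd-≤ j<k) (bd-mono k)
    ... | inj₂ refl = ℕₚ.≤-refl

    -- An admissible representation of level `k` and degree at most `bd k` satisfies the relations
    -- demanded at the next level, since these relations were tested on it.
    Eq-down₁ : ∀ {M} k {u v} → bd k ≤ M → Eq M (suc k) u v → Eq (bd k) k u v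
    Eq-down₁ k bd≤M p = eq λ M′ l σ i a x →
      sameAction p M′ (ℕₚ.≤-trans l bd≤M) σ i (λ w _ w≈ → w≈ M′ l σ i a) x

    Eq-down : ∀ {j k} → j ≤ k → ∀ {u v} → Eq (bd k) k u v → Eq (bd j) j u v
    Eq-down {j} {k} l p with ℕₚ.m≤n⇒m<n∨m≡n l
    ... | inj₂ refl = p
    Eq-down {j} {suc k} l p | inj₁ (s≤s j≤k) = Eq-down j≤k (Eq-down₁ k (bd-mono k) p)

    -- The word u v⁻¹ is one of the relations that admissibility at level k + 1 imposes, whatever
    -- the degree.
    Eq-up₁ : ∀ {k u v β} M → ∣ β ∣ ≤ k → u ⊑ β → v ⊑ β → Eq (bd k) k u v → Eq M (suc k) u v
    Eq-up₁ {k} {u} {v} {β} M β≤k u⊑β v⊑β p = eq λ M′ l σ i a x →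
      sym (trans (cong (act σ v) (sym (act-w i a x)))
        (trans (cong (act σ v) (act-++ σ u (inv v) x)) (act-inv′ i v _)))
      where
      act-w : ∀ {M′} {σ : Letters m M′} → Involutive σ → Admissible (suc k) σ → ∀ x →
        act σ (u ++ inv v) x ≡ x
      act-w i a = a (u ++ inv v) (β , β≤k , ⊑-++ u⊑β (⊑-inv v⊑β))
        (sameAction (Eq-trans (Eq-++ p Eq-refl) (Eq-cancelʳ v)))

    Eq-up : ∀ {j k u v β} → j ≤ k → ∣ β ∣ ≤ j → u ⊑ β → v ⊑ β → Eq (bd j) j u v → Eq (bd k) k u v
    Eq-up {j} {k} l β≤j u⊑β v⊑β p with ℕₚ.m≤n⇒m<n∨m≡n l
    ... | inj₂ refl = p
    Eq-up {j} {suc k} l β≤j u⊑β v⊑β p | inj₁ (s≤s j≤k) =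
      Eq-up₁ _ (ℕₚ.≤-trans β≤j j≤k) u⊑β v⊑β (Eq-up j≤k β≤j u⊑β v⊑β p)

    -- No bound is below `bd 0`, so by induction the representation itself was among those that
    -- decided the relations of each level.
    small-graph-admissible : ∀ k {M} {σ : Letters m M} → M ≤ bd 0 → Involutive σ → Admissible k σ
    small-graph-admissible zero l i = tt
    small-graph-admissible (suc k) {M} {σ} l i w _ w≈ x =
      w≈ M (ℕₚ.≤-trans l (bd-≤ {0} {k} z≤n)) σ i (small-graph-admissible k l i) x

    Eq-small-graph : ∀ {M₀ k u v} → bd 0 ≤ M₀ → Eq M₀ k u v →
      ∀ {M} (σ : Letters m M) → M ≤ bd 0 → Involutive σ → ∀ x → act σ u x ≡ act σ v x
    Eq-small-graph {k = k} l₀ p {M} σ l i =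
      sameAction p M (ℕₚ.≤-trans l l₀) σ i (small-graph-admissible k l i)

-- Free reduction and certificates for consequences of group relations

infixr 5 _⊕_
data Expr (n : ℕ) : Set where
  var : Fin n → Expr n
  _⊕_ : Expr n → Expr n → Expr n
  ⊖_ : Expr n → Expr n
  ∅ : Expr n

v₀ : ∀ {n} → Expr (1 + n)
v₀ = var zero
v₁ : ∀ {n} → Expr (2 + n)
v₁ = var (suc zero)
v₂ : ∀ {n} → Expr (3 + n)
v₂ = var (suc (suc zero))
v₃ : ∀ {n} → Expr (4 + n)
v₃ = var (suc (suc (suc zero)))
v₄ : ∀ {n} → Expr (5 + n)
v₄ = var (suc (suc (suc (suc zero))))
v₅ : ∀ {n} → Expr (6 + n)
v₅ = var (suc (suc (suc (suc (suc zero)))))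
v₆ : ∀ {n} → Expr (7 + n)
v₆ = var (suc (suc (suc (suc (suc (suc zero))))))
v₇ : ∀ {n} → Expr (8 + n)
v₇ = var (suc (suc (suc (suc (suc (suc (suc zero)))))))

v₈ : ∀ {n} → Expr (9 + n)
v₈ = var (suc (suc (suc (suc (suc (suc (suc (suc zero))))))))
v₉ : ∀ {n} → Expr (10 + n)
v₉ = var (suc (suc (suc (suc (suc (suc (suc (suc (suc zero)))))))))
v₁₀ : ∀ {n} → Expr (11 + n)
v₁₀ = var (suc (suc (suc (suc (suc (suc (suc (suc (suc (suc zero))))))))))

module _ {n : ℕ} where

  Normal : Set
  Normal = List (Fin n × Bool)

  cancels : Bool → Bool → Bool
  cancels true b = not b
  cancels false b = b

  push : Fin n → Bool → Normal → Normal
  push i s [] = (i , s) ∷ []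
  push i s ((j , t) ∷ ns) with i Finₚ.≟ j
  ... | no _ = (i , s) ∷ (j , t) ∷ ns
  ... | yes _ with cancels s t
  ...   | true = ns
  ...   | false = (i , s) ∷ (j , t) ∷ ns

  -- The Boolean is the sign with which the expression is read, `false` meaning inverted; the list
  -- is the already reduced word to its right.
  norm : Expr n → Bool → Normal → Normal
  norm (var i) s ns = push i s ns
  norm (a ⊕ b) true ns = norm a true (norm b true ns)
  norm (a ⊕ b) false ns = norm b false (norm a false ns)
  norm (⊖ a) s ns = norm a (not s) ns
  norm ∅ s ns = ns

module GroupSolver {c ℓ} (G : Group c ℓ) where
  open Group G renaming (refl to ≈-refl; sym to ≈-sym; trans to ≈-trans; reflexive to ≈-reflexive)
  open import Algebra.Properties.Group G using (⁻¹-anti-homo-∙; ⁻¹-involutive; ε⁻¹≈ε)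
  open import Relation.Binary.Reasoning.Setoid setoid

  module _ {n : ℕ} (ρ : Vec Carrier n) where

    ⟦_⟧ : Expr n → Carrier
    ⟦ var i ⟧ = lookup ρ i
    ⟦ a ⊕ b ⟧ = ⟦ a ⟧ ∙ ⟦ b ⟧
    ⟦ ⊖ a ⟧ = ⟦ a ⟧ ⁻¹
    ⟦ ∅ ⟧ = ε

    signed : Carrier → Bool → Carrier
    signed a true = a
    signed a false = a ⁻¹

    ⟦_⟧ₙ : Normal → Carrier
    ⟦ [] ⟧ₙ = ε
    ⟦ (i , s) ∷ ns ⟧ₙ = signed (lookup ρ i) s ∙ ⟦ ns ⟧ₙ

    push-sound : ∀ i s ns → signed (lookup ρ i) s ∙ ⟦ ns ⟧ₙ ≈ ⟦ push i s ns ⟧ₙ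
    push-sound i s [] = ≈-refl
    push-sound i s ((j , t) ∷ ns) with i Finₚ.≟ j
    ... | no _ = ≈-refl
    push-sound i true ((j , false) ∷ ns) | yes refl =
      ≈-trans (≈-sym (assoc _ _ _)) (≈-trans (∙-congʳ (inverseʳ _)) (identityˡ _))
    push-sound i true ((j , true) ∷ ns) | yes refl = ≈-refl
    push-sound i false ((j , false) ∷ ns) | yes refl = ≈-refl
    push-sound i false ((j , true) ∷ ns) | yes refl =
      ≈-trans (≈-sym (assoc _ _ _)) (≈-trans (∙-congʳ (inverseˡ _)) (identityˡ _))

    norm-sound : ∀ e s ns → signed ⟦ e ⟧ s ∙ ⟦ ns ⟧ₙ ≈ ⟦ norm e s ns ⟧ₙ
    norm-sound (var i) s ns = push-sound i s ns
    norm-sound (a ⊕ b) true ns =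
      ≈-trans (assoc _ _ _) (≈-trans (∙-congˡ (norm-sound b true ns)) (norm-sound a true _))
    norm-sound (a ⊕ b) false ns =
      ≈-trans (∙-congʳ (⁻¹-anti-homo-∙ _ _))
        (≈-trans (assoc _ _ _) (≈-trans (∙-congˡ (norm-sound a false ns)) (norm-sound b false _)))
    norm-sound (⊖ a) true ns = norm-sound a false ns
    norm-sound (⊖ a) false ns = ≈-trans (∙-congʳ (⁻¹-involutive _)) (norm-sound a true ns)
    norm-sound ∅ true ns = identityˡ _
    norm-sound ∅ false ns = ≈-trans (∙-congʳ ε⁻¹≈ε) (identityˡ _)

    -- One rewriting step from C·L·B to C·R·B, for any right context B.
    record Step : Set (c ⊔ˡ ℓ) where
      constructor rw
      field
        C L R : Expr n
        L≈R : ⟦ L ⟧ ≈ ⟦ R ⟧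

    -- Replacing C·L·B by C·R·B multiplies on the left by a conjugate of a relator; the quotient is
    -- C·L·R⁻¹·C⁻¹, in which the right context has cancelled.
    relator : List Step → Expr n
    relator [] = ∅
    relator (rw C L R _ ∷ ss) = (C ⊕ L ⊕ (⊖ R) ⊕ (⊖ C)) ⊕ relator ss

    relator-trivial : ∀ ss → ⟦ relator ss ⟧ ≈ ε
    relator-trivial [] = ≈-refl
    relator-trivial (rw C L R p ∷ ss) = begin
      (⟦ C ⟧ ∙ (⟦ L ⟧ ∙ (⟦ R ⟧ ⁻¹ ∙ ⟦ C ⟧ ⁻¹))) ∙ ⟦ relator ss ⟧
        ≈⟨ ∙-cong (∙-congˡ (≈-trans (∙-congʳ p) (≈-sym (assoc _ _ _)))) (relator-trivial ss) ⟩
      (⟦ C ⟧ ∙ ((⟦ R ⟧ ∙ ⟦ R ⟧ ⁻¹) ∙ ⟦ C ⟧ ⁻¹)) ∙ ε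
        ≈⟨ ≈-trans (identityʳ _) (∙-congˡ (≈-trans (∙-congʳ (inverseʳ _)) (identityˡ _))) ⟩
      ⟦ C ⟧ ∙ ⟦ C ⟧ ⁻¹
        ≈⟨ inverseʳ _ ⟩
      ε ∎

    -- Along a derivation from l to r the quotient l·r⁻¹ telescopes into the product of the relators
    -- of the steps. This is an identity in the free group, so comparing normal forms verifies it.
    rewriting : ∀ l r ss → norm (l ⊕ (⊖ r)) true [] ≡ norm (relator ss) true [] → ⟦ l ⟧ ≈ ⟦ r ⟧
    rewriting l r ss p = begin
      ⟦ l ⟧ ≈⟨ ≈-sym (≈-trans (assoc _ _ _) (≈-trans (∙-congˡ (inverseˡ _)) (identityʳ _))) ⟩
      (⟦ l ⟧ ∙ ⟦ r ⟧ ⁻¹) ∙ ⟦ r ⟧ ≈⟨ ∙-congʳ diff ⟩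
      ε ∙ ⟦ r ⟧ ≈⟨ identityˡ _ ⟩
      ⟦ r ⟧ ∎
      where
      normalised : ∀ e → ⟦ e ⟧ ≈ ⟦ norm e true [] ⟧ₙ
      normalised e = ≈-trans (≈-sym (identityʳ _)) (norm-sound e true [])
      diff : ⟦ l ⟧ ∙ ⟦ r ⟧ ⁻¹ ≈ ε
      diff = ≈-trans (normalised (l ⊕ (⊖ r)))
        (≈-trans (≈-reflexive (cong ⟦_⟧ₙ p))
          (≈-trans (≈-sym (normalised (relator ss))) (relator-trivial ss)))

-- Short representatives by the pigeonhole principle

module _ {m : ℕ} where

  -- All assignments of self-maps to letters are tested, involutive or not. The classes can then be
  -- counted by counting functions, and the relation implies `Eq` at every level.
  SameUpTo : ℕ → Word m → Word m → Set
  SameUpTo M u v = ∀ M′ → M′ ≤ M → (σ : Letters m M′) → ∀ x → act σ u x ≡ act σ v x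

  -- There are (M ^ M) ^ m assignments of degree M, and under each of them a word becomes one of M ^
  -- M self-maps.
  actionCodes : ℕ → ℕ
  actionCodes M = (M ^ M) ^ ((M ^ M) ^ m)

  decodeLetters : ∀ {M} → Fin ((M ^ M) ^ m) → Letters m M
  decodeLetters c e = finToFun (finToFun c e)

  actionCode : ∀ M → Word m → Fin (actionCodes M)
  actionCode M w = funToFin (λ c → funToFin (act (decodeLetters {M} c) w))

  funToFin-injective : ∀ {a b} {f g : Fin a → Fin b} → funToFin f ≡ funToFin g → ∀ x → f x ≡ g x
  funToFin-injective {f = f} {g} p x =
    trans (sym (Finₚ.finToFun-funToFin f x))
      (trans (cong (λ c → finToFun c x) p) (Finₚ.finToFun-funToFin g x))

  actionCode-sound : ∀ M u v → actionCode M u ≡ actionCode M v →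
    (σ : Letters m M) → ∀ x → act σ u x ≡ act σ v x
  actionCode-sound M u v p σ x =
    trans (sym (decoded u))
      (trans (funToFin-injective (funToFin-injective p c) x) (decoded v))
    where
    c : Fin ((M ^ M) ^ m)
    c = funToFin (funToFin ∘ σ)
    decoded : ∀ w → act (decodeLetters {M} c) w x ≡ act σ w x
    decoded w = act-cong (λ e y →
      trans (cong (λ d → finToFun d y) (Finₚ.finToFun-funToFin (funToFin ∘ σ) e))
        (Finₚ.finToFun-funToFin (σ e) y)) w x

  codes : ℕ → ℕ
  codes zero = actionCodes 0
  codes (suc M) = codes M * actionCodes (suc M)

  code : ∀ M → Word m → Fin (codes M)
  code zero w = actionCode 0 w
  code (suc M) w = combine (code M w) (actionCode (suc M) w)

  code-sound : ∀ M u v → code M u ≡ code M v → SameUpTo M u v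
  code-sound zero u v p .zero z≤n σ x = actionCode-sound 0 u v p σ x
  code-sound (suc M) u v p M′ l σ x
    with Finₚ.combine-injective (code M u) (actionCode (suc M) u) (code M v) (actionCode (suc M) v) p
  ... | p₁ , p₂ with ℕₚ.m≤n⇒m<n∨m≡n l
  ...   | inj₁ (s≤s l′) = code-sound M u v p₁ M′ l′ σ x
  ...   | inj₂ refl = actionCode-sound (suc M) u v p₂ σ x

  SameUpTo-++ : ∀ {M} u v w → SameUpTo M u v → SameUpTo M (u ++ w) (v ++ w)
  SameUpTo-++ u v w p M′ l σ x =
    trans (act-++ σ u w x) (trans (cong (act σ w) (p M′ l σ x)) (sym (act-++ σ v w x)))

  take-split : ∀ {i j} (w : Word m) → i < j → j ≤ length w →
    ∃[ z ] ∃[ r ] (w ≡ take i w ++ z ++ r × take j w ≡ take i w ++ z × length (take i w ++ r) < length w)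
  take-split {zero} {suc j} (e ∷ w) _ (s≤s l) =
    take (suc j) (e ∷ w) , drop j w , cong (e ∷_) (sym (Listₚ.take++drop≡id j w)) , refl ,
    s≤s (ℕₚ.≤-trans (ℕₚ.≤-reflexive (Listₚ.length-drop j w)) (ℕₚ.m∸n≤m (length w) j))
  take-split {suc i} {suc j} (e ∷ w) (s≤s i<j) (s≤s l) with take-split w i<j l
  ... | z , r , p , q , len = z , r , cong (e ∷_) p , cong (e ∷_) q , s≤s len

  module _ (M : ℕ) {ℓ} (P : Word m → Set ℓ)
    (cut : ∀ u z r → SameUpTo M u (u ++ z) → P (u ++ z ++ r) → P (u ++ r)) where

    prefix-same : ∀ w {n} (i j : Fin n) {z} → take (toℕ j) w ≡ take (toℕ i) w ++ z →
      code M (take (toℕ i) w) ≡ code M (take (toℕ j) w) → SameUpTo M (take (toℕ i) w) (take (toℕ i) w ++ z)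
    prefix-same w i j {z} take≡ same-code =
      subst (SameUpTo M (take (toℕ i) w)) take≡ (code-sound M (take (toℕ i) w) (take (toℕ j) w) same-code)

    -- Two prefixes of a word longer than `codes M` act alike, and the segment between them can be
    -- cut out. `P` is what the cut has to preserve: the set of letters used, or being a walk with
    -- given ends.
    shorten-fuel : ∀ f w → length w ≤ f → P w →
      ∃[ w′ ] (length w′ ≤ codes M × SameUpTo M w′ w × P w′)
    shorten-fuel f w l pw with length w ℕₚ.≤? codes M
    ... | yes short = w , short , (λ _ _ _ _ → refl) , pw
    shorten-fuel zero w l pw | no long = ⊥-elim (long (ℕₚ.≤-trans l z≤n))
    shorten-fuel (suc f) w l pw | no long
      with Finₚ.pigeonhole (ℕₚ.≰⇒> long) (λ i → code M (take (toℕ i) w))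
    ... | i , j , i<j , same-code
      with take-split w i<j (ℕₚ.<⇒≤ (Finₚ.toℕ<n j))
    ... | z , r , w≡ , take≡ , shorter
      with shorten-fuel f (take (toℕ i) w ++ r) (ℕₚ.≤-pred (ℕₚ.≤-trans shorter l))
             (cut (take (toℕ i) w) z r (prefix-same w i j take≡ same-code) (subst P w≡ pw))
    ... | w′ , short , w′~ , pw′ = w′ , short , same′ , pw′
      where
      same′ : SameUpTo M w′ w
      same′ M′ l′ σ x = trans (w′~ M′ l′ σ x)
        (trans (SameUpTo-++ (take (toℕ i) w) (take (toℕ i) w ++ z) r (prefix-same w i j take≡ same-code) M′ l′ σ x)
          (cong (λ v → act σ v x) (trans (Listₚ.++-assoc (take (toℕ i) w) z r) (sym w≡))))

    shorten : ∀ w → P w → ∃[ w′ ] (length w′ ≤ codes M × SameUpTo M w′ w × P w′)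
    shorten w = shorten-fuel (length w) w ℕₚ.≤-refl

  -- Words of length at most L are padded to L symbols; the additional symbol `zero` is a blank.
  wordCount : ℕ → ℕ
  wordCount L = suc m ^ L

  readWord : ∀ L → (Fin L → Fin (suc m)) → Word m
  readWord zero f = []
  readWord (suc L) f with f zero
  ... | zero = readWord L (f ∘ suc)
  ... | suc e = e ∷ readWord L (f ∘ suc)

  readWord-cong : ∀ L {f g} → (∀ i → f i ≡ g i) → readWord L f ≡ readWord L g
  readWord-cong zero p = refl
  readWord-cong (suc L) {f} {g} p with f zero | g zero | p zero
  ... | zero | .zero | refl = readWord-cong L (p ∘ suc)
  ... | suc e | .(suc e) | refl = cong (e ∷_) (readWord-cong L (p ∘ suc))

  writeWord : ∀ L → Word m → Fin L → Fin (suc m)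
  writeWord (suc L) [] i = zero
  writeWord (suc L) (e ∷ w) zero = suc e
  writeWord (suc L) (e ∷ w) (suc i) = writeWord L w i

  writeWord-[] : ∀ L i → zero ≡ writeWord L [] i
  writeWord-[] (suc L) i = refl

  readWord-writeWord : ∀ L w → length w ≤ L → readWord L (writeWord L w) ≡ w
  readWord-writeWord zero [] l = refl
  readWord-writeWord (suc L) [] l =
    trans (readWord-cong L (writeWord-[] L)) (readWord-writeWord L [] z≤n)
  readWord-writeWord (suc L) (e ∷ w) (s≤s l) = cong (e ∷_) (readWord-writeWord L w l)

  nthWord : ∀ L → Fin (wordCount L) → Word m
  nthWord L c = readWord L (finToFun c)

  nthWord-surjective : ∀ L w → length w ≤ L → ∃[ c ] (nthWord L c ≡ w)
  nthWord-surjective L w l = funToFin (writeWord L w) ,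
    trans (readWord-cong L (Finₚ.finToFun-funToFin (writeWord L w))) (readWord-writeWord L w l)

-- Graphs with partial moves

-- Where a letter has no move it acts as the identity, see Step.
record Graph (m : ℕ) : Set₁ where
  infix 4 _~_
  field
    Vertex : Set
    _~_ : Vertex → Vertex → Set
    ~refl : ∀ {x} → x ~ x
    ~sym : ∀ {x y} → x ~ y → y ~ x
    ~trans : ∀ {x y z} → x ~ y → y ~ z → x ~ z
    ~stable : ∀ {x y} → ¬ ¬ (x ~ y) → x ~ y
    Move : Fin m → Vertex → Vertex → Set
    move-resp : ∀ {e x x′ y y′} → x ~ x′ → y ~ y′ → Move e x y → Move e x′ y′
    move-sym : ∀ {e x y} → Move e x y → Move e y x
    move-functional : ∀ {e x y z} → Move e x y → Move e x z → y ~ z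

  Step : Fin m → Vertex → Vertex → Set
  Step e x y = Move e x y ⊎ ((∀ z → ¬ Move e x z) × x ~ y)

  step-total : ∀ e x → ¬ ¬ ∃ (Step e x)
  step-total e x = do
    yes (y , mv) ← em {A = ∃ (Move e x)}
      where no stuck → return (x , inj₂ ((λ z mv → stuck (z , mv)) , ~refl))
    return (y , inj₁ mv)

  step-functional : ∀ {e x y z} → Step e x y → Step e x z → y ~ z
  step-functional (inj₁ p) (inj₁ q) = move-functional p q
  step-functional (inj₁ p) (inj₂ (stuck , _)) = ⊥-elim (stuck _ p)
  step-functional (inj₂ (stuck , _)) (inj₁ q) = ⊥-elim (stuck _ q)
  step-functional (inj₂ (_ , p)) (inj₂ (_ , q)) = ~trans (~sym p) q

  step-resp : ∀ {e x x′ y y′} → x ~ x′ → y ~ y′ → Step e x y → Step e x′ y′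
  step-resp p q (inj₁ mv) = inj₁ (move-resp p q mv)
  step-resp p q (inj₂ (stuck , r)) =
    inj₂ ((λ z mv → stuck z (move-resp (~sym p) ~refl mv)) , ~trans (~sym p) (~trans r q))

  step-sym : ∀ {e x y} → Step e x y → Step e y x
  step-sym (inj₁ mv) = inj₁ (move-sym mv)
  step-sym (inj₂ (stuck , r)) = inj₂ ((λ z mv → stuck z (move-resp (~sym r) ~refl mv)) , ~sym r)

  Path : Word m → Vertex → Vertex → Set
  Path [] x y = x ~ y
  Path (e ∷ w) x y = ∃[ z ] (Step e x z × Path w z y)

  path-respˡ : ∀ w {x x′ y} → x ~ x′ → Path w x y → Path w x′ y
  path-respˡ [] p q = ~trans (~sym p) q
  path-respˡ (e ∷ w) p (z , s , q) = z , step-resp p ~refl s , q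

  path-respʳ : ∀ w {x y y′} → y ~ y′ → Path w x y → Path w x y′
  path-respʳ [] p q = ~trans q p
  path-respʳ (e ∷ w) p (z , s , q) = z , s , path-respʳ w p q

  path-functional : ∀ w {x y z} → Path w x y → Path w x z → y ~ z
  path-functional [] p q = ~trans (~sym p) q
  path-functional (e ∷ w) (_ , s , p) (_ , t , q) =
    path-functional w p (path-respˡ w (step-functional t s) q)

  path-++ : ∀ u {v x y z} → Path u x y → Path v y z → Path (u ++ v) x z
  path-++ [] {v} p q = path-respˡ v (~sym p) q
  path-++ (e ∷ u) (_ , s , p) q = _ , s , path-++ u p q

  path-inv : ∀ w {x y} → Path w x y → Path (inv w) y x
  path-inv [] p = ~sym p
  path-inv (e ∷ w) (_ , s , p) = path-++ (inv w) (path-inv w p) (_ , step-sym s , ~refl)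

  path-total : ∀ w x → ¬ ¬ ∃ (Path w x)
  path-total [] x = return (x , ~refl)
  path-total (e ∷ w) x = do
    z , s ← step-total e x
    y , p ← path-total w z
    return (y , z , s , p)

  Reach : Subset m → Vertex → Vertex → Set
  Reach β x y = ∃[ w ] (w ⊑ β × Path w x y)

  reach-trans : ∀ {β x y z} → Reach β x y → Reach β y z → Reach β x z
  reach-trans (u , u⊑β , p) (v , v⊑β , q) = u ++ v , ⊑-++ u⊑β v⊑β , path-++ u p q

  reach-sym : ∀ {β x y} → Reach β x y → Reach β y x
  reach-sym (u , u⊑β , p) = inv u , ⊑-inv u⊑β , path-inv u p

  reach-refl : ∀ {β x y} → x ~ y → Reach β x y
  reach-refl p = [] , [] , p

  reach-move : ∀ {β e x y} → e ∈ β → Move e x y → Reach β x y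
  reach-move e∈β mv = _ ∷ [] , e∈β ∷ [] , _ , inj₁ mv , ~refl

  path-invariant : ∀ {ℓ} (P : Vertex → Set ℓ) {β} → (∀ {x y} → x ~ y → P x → P y) →
    (∀ {e x y} → e ∈ β → Move e x y → P x → P y) → ∀ {w x y} → w ⊑ β → Path w x y → P x → P y
  path-invariant P resp step [] p px = resp p px
  path-invariant P resp step (e∈β ∷ w⊑β) (_ , inj₁ mv , p) px =
    path-invariant P resp step w⊑β p (step e∈β mv px)
  path-invariant P resp step (_ ∷ w⊑β) (_ , inj₂ (_ , r) , p) px =
    path-invariant P resp step w⊑β p (resp r px)

open Graph public using (Vertex)

module _ {m : ℕ} (G : Graph m) where
  open Graph G

  restrict : Subset m → Graph m
  restrict β = record
    { Vertex = Vertex G ; _~_ = _~_ ; ~refl = ~refl ; ~sym = ~sym ; ~trans = ~trans ; ~stable = ~stable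
    ; Move = λ e x y → e ∈ β × Move e x y
    ; move-resp = λ { p q (e∈β , mv) → e∈β , move-resp p q mv }
    ; move-sym = λ { (e∈β , mv) → e∈β , move-sym mv }
    ; move-functional = λ { (_ , p) (_ , q) → move-functional p q } }

  module R β = Graph (restrict β)

  path-restrict : ∀ β w {x y} → w ⊑ β → Path w x y → R.Path β w x y
  path-restrict β [] [] p = p
  path-restrict β (e ∷ w) (e∈β ∷ w⊑β) (z , inj₁ mv , p) = z , inj₁ (e∈β , mv) , path-restrict β w w⊑β p
  path-restrict β (e ∷ w) (e∈β ∷ w⊑β) (z , inj₂ (stuck , r) , p) =
    z , inj₂ ((λ { y (_ , mv) → stuck y mv }) , r) , path-restrict β w w⊑β p

  path-unrestrict : ∀ β w {x y} → R.Path β w x y → Path (w ↾ β) x y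
  path-unrestrict β [] p = p
  path-unrestrict β (e ∷ w) (z , s , p) with e Subₚ.∈? β | s
  ... | yes e∈β | inj₁ (_ , mv) = z , inj₁ mv , path-unrestrict β w p
  ... | yes e∈β | inj₂ (stuck , r) = z , inj₂ ((λ y mv → stuck y (e∈β , mv)) , r) , path-unrestrict β w p
  ... | no e∉β | inj₁ (e∈β , _) = ⊥-elim (e∉β e∈β)
  ... | no e∉β | inj₂ (_ , r) = path-respˡ (w ↾ β) (~sym r) (path-unrestrict β w p)

-- Turning graphs into permutation representations

firstTrue : ∀ {n} → (Fin n → Bool) → Maybe (Fin n)
firstTrue {zero} b = nothing
firstTrue {suc n} b = if b zero then just zero else Data.Maybe.map suc (firstTrue (b ∘ suc))

firstTrue-cong : ∀ {n} {b c : Fin n → Bool} → (∀ i → b i ≡ c i) → firstTrue b ≡ firstTrue c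
firstTrue-cong {zero} p = refl
firstTrue-cong {suc n} {b} {c} p with b zero | c zero | p zero
... | true | .true | refl = refl
... | false | .false | refl = cong (Data.Maybe.map suc) (firstTrue-cong (p ∘ suc))

firstTrue-found : ∀ {n} (b : Fin n → Bool) i → b i ≡ true → ∃[ j ] (firstTrue b ≡ just j × b j ≡ true)
firstTrue-found b zero p rewrite p = zero , refl , p
firstTrue-found b (suc i) p with b zero in q
... | true = zero , refl , q
... | false with firstTrue-found (b ∘ suc) i p
...   | j , r , s = suc j , cong (Data.Maybe.map suc) r , s

module Transfer {m : ℕ} (bd : ℕ → ℕ) (G : Graph m) where
  open Tower {m} bd
  open Graph G

  GraphAdmissible : ℕ → Set
  GraphAdmissible zero = Unit
  GraphAdmissible (suc k) = ∀ w → Small k w → Eq (bd k) k w [] → ∀ x y → Path w x y → x ~ y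

  -- Every vertex is represented by its least index; the redundant indices become fixed points.
  module Simulation {M : ℕ} (f : Fin M → Vertex G) (_~?_ : ∀ i j → Dec (f i ~ f j))
    (t : Letters m M) (t-step : ∀ e i → Step e (f i) (f (t e i))) where

    canon : Fin M → Fin M
    canon i = fromMaybe i (firstTrue (λ j → does (i ~? j)))

    does-true : ∀ {i j} → does (i ~? j) ≡ true → f i ~ f j
    does-true {i} {j} p with i ~? j
    ... | yes q = q

    canon-found : ∀ i → ∃[ j ] (firstTrue (λ j → does (i ~? j)) ≡ just j × does (i ~? j) ≡ true)
    canon-found i = firstTrue-found _ i (dec-true (i ~? i) ~refl)

    canon-~ : ∀ i → f i ~ f (canon i)
    canon-~ i with canon-found i
    ... | j , p , q rewrite p = does-true q

    does-cong : ∀ {i j} → f i ~ f j → ∀ l → does (i ~? l) ≡ does (j ~? l)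
    does-cong {i} {j} p l with j ~? l
    ... | yes q = dec-true (i ~? l) (~trans p q)
    ... | no ¬q = dec-false (i ~? l) (λ r → ¬q (~trans (~sym p) r))

    canon-cong : ∀ {i j} → f i ~ f j → canon i ≡ canon j
    canon-cong {i} {j} p with canon-found i | canon-found j
    ... | a , q , _ | b , r , _ with trans (sym q) (trans (firstTrue-cong (does-cong p)) r)
    ...   | refl rewrite q | r = refl

    canon-canon : ∀ i → canon (canon i) ≡ canon i
    canon-canon i = canon-cong (~sym (canon-~ i))

    simulated : Letters m M
    simulated e i with canon i Finₚ.≟ i
    ... | yes _ = canon (t e i)
    ... | no _ = i

    simulated-canon : ∀ e i → canon i ≡ i → simulated e i ≡ canon (t e i)
    simulated-canon e i p with canon i Finₚ.≟ i
    ... | yes _ = refl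
    ... | no ¬p = ⊥-elim (¬p p)

    simulated-redundant : ∀ e i → ¬ canon i ≡ i → simulated e i ≡ i
    simulated-redundant e i ¬p with canon i Finₚ.≟ i
    ... | yes p = ⊥-elim (¬p p)
    ... | no _ = refl

    simulated-step : ∀ e i → canon i ≡ i → Step e (f i) (f (simulated e i))
    simulated-step e i p rewrite simulated-canon e i p = step-resp ~refl (canon-~ (t e i)) (t-step e i)

    simulated-is-canon : ∀ e i → canon i ≡ i → canon (simulated e i) ≡ simulated e i
    simulated-is-canon e i p rewrite simulated-canon e i p = canon-canon (t e i)

    simulated-involutive : Involutive simulated
    simulated-involutive e i with canon i Finₚ.≟ i
    ... | no ¬p = simulated-redundant e i ¬p
    ... | yes p = trans (simulated-canon e _ (canon-canon (t e i)))
      (trans (canon-cong (step-functional (t-step e (canon (t e i)))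
        (step-sym (step-resp ~refl (canon-~ (t e i)) (t-step e i))))) p)

    simulated-path : ∀ w i → canon i ≡ i →
      canon (act simulated w i) ≡ act simulated w i × Path w (f i) (f (act simulated w i))
    simulated-path [] i p = p , ~refl
    simulated-path (e ∷ w) i p with simulated-path w (simulated e i) (simulated-is-canon e i p)
    ... | q , r = q , _ , simulated-step e i p , r

    act-redundant : ∀ w i → ¬ canon i ≡ i → act simulated w i ≡ i
    act-redundant [] i ¬p = refl
    act-redundant (e ∷ w) i ¬p rewrite simulated-redundant e i ¬p = act-redundant w i ¬p

    simulated-admissible : ∀ k → GraphAdmissible k → Admissible k simulated
    simulated-admissible zero a = tt
    simulated-admissible (suc k) a w small w≈ i with canon i Finₚ.≟ i
    ... | no ¬p = act-redundant w i ¬p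
    ... | yes p with simulated-path w i p
    ...   | q , path = trans (sym q)
      (trans (sym (canon-cong (a w small (eq w≈) (f i) _ path))) p)

  -- The names number the vertices reached from `x₀`, and `Simulation` makes the numbering a
  -- permutation representation of degree `M`, in which u and v act alike. The decisions this takes
  -- are finitely many, hence available under double negation, and the goal is stable.
  transfer : ∀ {M k} → GraphAdmissible k → (x₀ : Vertex G) (Names : Fin M → Vertex G → Set) →
    (∀ {i x y} → Names i x → Names i y → x ~ y) →
    (∀ {w y} → Path w x₀ y → ¬ ¬ (∃[ i ] Names i y)) →
    ∀ {u v y z} → Eq M k u v → Path u x₀ y → Path v x₀ z → y ~ z
  transfer {M} {k} a x₀ Names names-functional named {u} {v} {y} {z} u≈v pu pv = ~stable $ do
    D ← ¬¬-Fin λ i → em {A = Named i}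
    E ← ¬¬-Fin λ i → ¬¬-Fin λ j → em {A = pick (D i) ~ pick (D j)}
    T ← ¬¬-Fin λ e → ¬¬-Fin λ i → step-index D e i
    i₀ , p₀ ← index D x₀ ([] , ~refl)
    return (conclude D E (λ e i → proj₁ (T e i)) (λ e i → proj₂ (T e i)) i₀ p₀)
    where
    Reached : Vertex G → Set
    Reached y = ∃[ w ] Path w x₀ y
    Named : Fin M → Set
    Named i = ∃[ y ] (Reached y × Names i y)
    pick : ∀ {i} → Dec (Named i) → Vertex G
    pick (yes (y , _)) = y
    -- An index naming no reached vertex is sent to `x₀`, so that every picked vertex is reached.
    pick (no _) = x₀
    pick-reached : ∀ {i} (d : Dec (Named i)) → Reached (pick d)
    pick-reached (yes (_ , r , _)) = r
    pick-reached (no _) = [] , ~refl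
    pick-named : ∀ {i y} (d : Dec (Named i)) → Reached y → Names i y → pick d ~ y
    pick-named (yes (_ , _ , n)) r n′ = names-functional n n′
    pick-named (no ¬p) r n′ = ⊥-elim (¬p (_ , r , n′))
    index : (D : ∀ i → Dec (Named i)) → ∀ y → Reached y → ¬ ¬ (∃[ i ] (pick (D i) ~ y))
    index D y (w , p) = do
      i , n ← named {w} p
      return (i , pick-named (D i) (w , p) n)
    step-index : (D : ∀ i → Dec (Named i)) → ∀ e i → ¬ ¬ (∃[ j ] Step e (pick (D i)) (pick (D j)))
    step-index D e i = do
      y , s ← step-total e (pick (D i))
      let w , p = pick-reached (D i)
      j , q ← index D y (w ++ e ∷ [] , path-++ w p (y , s , ~refl))
      return (j , step-resp ~refl (~sym q) s)
    conclude : (D : ∀ i → Dec (Named i)) → (∀ i j → Dec (pick (D i) ~ pick (D j))) →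
      (t : Letters m M) → (∀ e i → Step e (pick (D i)) (pick (D (t e i)))) →
      ∀ i₀ → pick (D i₀) ~ x₀ → y ~ z
    conclude D E t t-step i₀ p₀ = ~trans
      (path-functional u (path-respˡ u (~sym start) pu) (proj₂ (simulated-path u j (canon-canon i₀))))
      (path-functional v (subst (λ i → Path v (f j) (f i)) (sym same-end) (proj₂ (simulated-path v j (canon-canon i₀))))
        (path-respˡ v (~sym start) pv))
      where
      f : Fin M → Vertex G
      f i = pick (D i)
      open Simulation f E t t-step
      j : Fin M
      j = canon i₀
      start : f j ~ x₀
      start = ~trans (~sym (canon-~ i₀)) p₀
      same-end : act simulated u j ≡ act simulated v j
      same-end = sameAction u≈v M ℕₚ.≤-refl simulated simulated-involutive (simulated-admissible k a) j

-- Admissibility from local conditions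

module Locality {m : ℕ} (bd : ℕ → ℕ) (bd-mono : ∀ k → bd k ≤ bd (suc k)) (G : Graph m) where
  open Tower {m} bd
  open Monotone bd-mono
  open Transfer bd G using (GraphAdmissible)
  open Graph G

  Free : ℕ → Subset m → Vertex G → Set
  Free k β x = ∀ w → w ⊑ β → Eq (bd k) k w [] → ∀ y → Path w x y → x ~ y

  record Bounded (M : ℕ) (β : Subset m) (x : Vertex G) : Set₁ where
    field
      Names : Fin M → Vertex G → Set
      names-functional : ∀ {i y z} → Names i y → Names i z → y ~ z
      named : ∀ {y} → Reach β x y → ¬ ¬ (∃[ i ] Names i y)

  widen : ∀ {M M′ β x} → M ≤ M′ → Bounded M β x → Bounded M′ β x
  widen {M} {M′} M≤M′ b = record
    { Names = λ c y → ∃[ i ] (inject≤ i M≤M′ ≡ c × Names i y)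
    ; names-functional = λ { (i , p , n) (j , q , n′) → names-functional n
        (subst (λ l → Names l _) (Finₚ.inject≤-injective M≤M′ M≤M′ j i (trans q (sym p))) n′) }
    ; named = λ r → named r >>= λ { (i , n) → return (inject≤ i M≤M′ , i , refl , n) } }
    where open Bounded b

  -- Conjugation by a β-word leading from x to y carries trivial words at x to trivial words at y.
  free-transport : ∀ {k β x y} → Reach β x y → Free k β y → Free k β x
  free-transport {k} {β} {x} {y} (u , u⊑β , pu) free w w⊑β w≈ z pw = ~stable $ do
    z′ , pz ← path-total u z
    let y~z′ = free (inv u ++ w ++ u) (⊑-++ (⊑-inv u⊑β) (⊑-++ w⊑β u⊑β)) conj≈ z′
                 (path-++ (inv u) (path-inv u pu) (path-++ w pw pz))
    return (path-functional (inv u) (path-inv u pu) (path-respˡ (inv u) (~sym y~z′) (path-inv u pz)))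
    where
    open GroupSolver (Eq-group (bd k) k)
    conj≈ : Eq (bd k) k (inv u ++ w ++ u) []
    conj≈ = rewriting (u ∷ w ∷ []) ((⊖ v₀) ⊕ v₁ ⊕ v₀) ∅ (rw (⊖ v₀) v₁ ∅ w≈ ∷ []) refl

  path-support : ∀ {α} → (∀ {e x y} → Move e x y → e ∈ α) → ∀ w {x y} → Path w x y → Path (w ↾ α) x y
  path-support only [] p = p
  path-support {α} only (e ∷ w) (z , s , p) with e Subₚ.∈? α | s
  ... | yes _ | _ = z , s , path-support only w p
  ... | no e∉α | inj₁ mv = ⊥-elim (e∉α (only mv))
  ... | no _ | inj₂ (_ , r) = path-respˡ (w ↾ α) (~sym r) (path-support only w p)

  module _ {α : Subset m} (only : ∀ {e x y} → Move e x y → e ∈ α) {k : ℕ}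
    (local : ∀ β → β ⊆ α → ∣ β ∣ ≤ k → ∀ x → ¬ ¬ (Free k β x ⊎ Bounded (bd ∣ β ∣) β x)) where

    -- Induction on the size of β. A bounded component, with all letters outside β idle, is a
    -- representation of degree at most `bd ∣ β ∣`. Admissibility at level ∣ β ∣ concerns only sets
    -- smaller than β, which are free by induction; hence trivial words over β close up in it too.
    free-everywhere : ∀ n β → ∣ β ∣ ≤ n → β ⊆ α → ∣ β ∣ ≤ k → ∀ x → Free k β x
    restricted-admissible : ∀ n β → ∣ β ∣ ≤ n → β ⊆ α → ∣ β ∣ ≤ k → ∀ j → j ≤ ∣ β ∣ →
      Transfer.GraphAdmissible bd (restrict G β) j

    restricted-admissible n β β≤n β⊆α β≤k zero l = tt
    restricted-admissible zero β β≤n β⊆α β≤k (suc j) l with ℕₚ.≤-trans l β≤n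
    ... | ()
    restricted-admissible (suc n) β β≤n β⊆α β≤k (suc j) l w (γ , γ≤j , w⊑γ) w≈ x y p =
      free-everywhere n (γ ∩ β) (ℕₚ.≤-trans γβ≤j (ℕₚ.≤-pred (ℕₚ.≤-trans l β≤n)))
        (λ e∈ → β⊆α (Subₚ.p∩q⊆q γ β e∈)) (ℕₚ.≤-trans γβ≤j j≤k) x (w ↾ β) wβ⊑
        (Eq-up j≤k γβ≤j wβ⊑ [] (Eq-↾ j β w≈)) y (path-unrestrict G β w p)
      where
      γβ≤j : ∣ γ ∩ β ∣ ≤ j
      γβ≤j = ℕₚ.≤-trans (Subₚ.∣p∩q∣≤∣p∣ γ β) γ≤j
      j≤k : j ≤ k
      j≤k = ℕₚ.≤-trans (ℕₚ.n≤1+n j) (ℕₚ.≤-trans l β≤k)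
      wβ⊑ : w ↾ β ⊑ γ ∩ β
      wβ⊑ = ⊑-∩ (↾-keeps β w⊑γ) (↾-⊑ w β)

    free-everywhere n β β≤n β⊆α β≤k x w w⊑β w≈ y p = ~stable $ do
      inj₂ bounded ← local β β⊆α β≤k x
        where inj₁ free → return (free w w⊑β w≈ y p)
      let open Bounded bounded
      return (~sym (Transfer.transfer bd (restrict G β)
        (restricted-admissible n β β≤n β⊆α β≤k ∣ β ∣ ℕₚ.≤-refl) x Names names-functional
        (λ {w} q → named (w ↾ β , ↾-⊑ w β , path-unrestrict G β w q))
        (Eq-down β≤k w≈) (path-restrict G β w w⊑β p) ~refl))

    local-admissible : GraphAdmissible (suc k)
    local-admissible w (γ , γ≤k , w⊑γ) w≈ x y p =
      free-everywhere k (γ ∩ α) γα≤k (Subₚ.p∩q⊆q γ α) γα≤k x (w ↾ α)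
        (⊑-∩ (↾-keeps α w⊑γ) (↾-⊑ w α)) (Eq-↾ k α w≈) y (path-support only w p)
      where
      γα≤k : ∣ γ ∩ α ∣ ≤ k
      γα≤k = ℕₚ.≤-trans (Subₚ.∣p∩q∣≤∣p∣ γ α) γ≤k

-- Chains of cosets

module _ {m : ℕ} where

  reps : ℕ → ℕ
  reps M = wordCount {m} (codes {m} M)

  rep : ∀ M → Fin (reps M) → Word m
  rep M = nthWord (codes {m} M)

  prefixWord : (ℕ → Word m) → ℕ → Word m
  prefixWord w zero = []
  prefixWord w (suc i) = prefixWord w i ++ w i

module _ {m : ℕ} (bd : ℕ → ℕ) where
  open Tower {m} bd

  sameUpTo⇒Eq : ∀ {M k u v} → SameUpTo M u v → Eq M k u v
  sameUpTo⇒Eq p = eq λ M′ l σ _ _ → p M′ l σ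

  short-rep : ∀ M k {w β} → w ⊑ β → ∃[ r ] (rep M r ⊑ β × Eq M k (rep M r) w)
  short-rep M k {w} {β} w⊑β with shorten M (_⊑ β) cut w w⊑β
    where
    cut : ∀ u z r → SameUpTo M u (u ++ z) → u ++ z ++ r ⊑ β → u ++ r ⊑ β
    cut u z r _ p = ⊑-++ (Allₚ.++⁻ˡ u p) (Allₚ.++⁻ʳ z (Allₚ.++⁻ʳ u p))
  ... | w′ , short , w′~w , w′⊑β with nthWord-surjective (codes {m} M) w′ short
  ...   | r , p = r , subst (_⊑ β) (sym p) w′⊑β , subst (λ v → Eq M k v w) (sym p) (sameUpTo⇒Eq w′~w)

module Chain {m : ℕ} (bd : ℕ → ℕ) (bd-mono : ∀ k → bd k ≤ bd (suc k)) (mid : ℕ → ℕ) (N : ℕ)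
  (mid≤bd : ∀ k → mid k ≤ bd (suc k)) (pieces≤mid : ∀ k → N * reps {m} (bd k) ≤ mid k)
  (k : ℕ) (γ : ℕ → Subset m) (γ≤k : ∀ i → ∣ γ i ∣ ≤ k) (w : ℕ → Word m) (w⊑γ : ∀ i → w i ⊑ γ i) where
  open Tower {m} bd
  open Monotone bd-mono
  open GroupSolver (Eq-group (bd k) k)

  infix 4 _≈_
  _≈_ : Word m → Word m → Set
  _≈_ = Eq (bd k) k

  -- The failure of separation at side `suc i`: the coset of ⟨γ i ∩ γ (suc i)⟩ at its beginning
  -- meets the coset of ⟨γ (suc i) ∩ γ (suc (suc i))⟩ at its end.
  Unseparated : ℕ → Set
  Unseparated i = ∃[ v ] ∃[ v′ ]
    (v ⊑ γ i × v ⊑ γ (suc i) × v′ ⊑ γ (suc i) × v′ ⊑ γ (suc (suc i)) × w (suc i) ≈ v ++ v′)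

  module Amalgam (n : ℕ) (n≤N : n ≤ N) (separated : ∀ i → suc (suc i) < n → ¬ Unseparated i) where

    record Point : Set where
      constructor pt
      field
        idx : ℕ
        idx<n : idx < n
        word : Word m
        word⊑ : word ⊑ γ idx
    open Point

    -- Piece suc i is glued to piece i along the coset w i · ⟨γ i ∩ γ (suc i)⟩.
    data _≋_ : Point → Point → Set where
      same : ∀ {i l l′ h h′ p p′} → h ≈ h′ → pt i l h p ≋ pt i l′ h′ p′
      forth : ∀ {i l l′ h h′ p p′} z → z ⊑ γ i → z ⊑ γ (suc i) → h ≈ w i ++ z → h′ ≈ z →
        pt i l h p ≋ pt (suc i) l′ h′ p′
      back : ∀ {i l l′ h h′ p p′} z → z ⊑ γ i → z ⊑ γ (suc i) → h ≈ w i ++ z → h′ ≈ z →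
        pt (suc i) l′ h′ p′ ≋ pt i l h p

    ≋-sym : ∀ {x y} → x ≋ y → y ≋ x
    ≋-sym (same p) = same (Eq-sym p)
    ≋-sym (forth z a b p q) = back z a b p q
    ≋-sym (back z a b p q) = forth z a b p q

    unseparated : ∀ {i h z z′} → z ⊑ γ i → z ⊑ γ (suc i) → z′ ⊑ γ (suc i) → z′ ⊑ γ (suc (suc i)) →
      h ≈ z → h ≈ w (suc i) ++ z′ → Unseparated i
    unseparated {i} {h} {z} {z′} a b c d p q = z , inv z′ , a , b , ⊑-inv c , ⊑-inv d ,
      rewriting (w (suc i) ∷ z′ ∷ h ∷ z ∷ []) v₀ (v₃ ⊕ (⊖ v₁))
        (rw ∅ (v₀ ⊕ v₁) v₂ (Eq-sym q) ∷ rw ∅ v₂ v₃ p ∷ []) refl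

    -- Two gluings in the same direction would put a point of the middle piece into both of its
    -- gluing cosets and make its side unseparated. So identifications never reach beyond
    -- neighbouring pieces.
    ≋-trans : ∀ {x y z} → x ≋ y → y ≋ z → x ≋ z
    ≋-trans (same p) (same q) = same (Eq-trans p q)
    ≋-trans (same p) (forth z a b q r) = forth z a b (Eq-trans p q) r
    ≋-trans (same p) (back z a b q r) = back z a b q (Eq-trans p r)
    ≋-trans (forth z a b p q) (same r) = forth z a b p (Eq-trans (Eq-sym r) q)
    ≋-trans (forth z a b p q) (forth {l′ = l″} z′ c d r s) =
      ⊥-elim (separated _ l″ (unseparated a b c d q r))
    ≋-trans (forth z a b p q) (back z′ c d r s) = same
      (Eq-trans p (Eq-trans (Eq-++ Eq-refl (Eq-trans (Eq-sym q) s)) (Eq-sym r)))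
    ≋-trans (back z a b p q) (same r) = back z a b (Eq-trans (Eq-sym r) p) q
    ≋-trans (back z a b p q) (forth z′ c d r s) = same (Eq-trans q (Eq-trans
      (rewriting (z ∷ z′ ∷ w _ ∷ _ ∷ []) v₀ v₁
        (rw (⊖ v₂) (v₂ ⊕ v₀) v₃ (Eq-sym p) ∷ rw (⊖ v₂) v₃ (v₂ ⊕ v₁) r ∷ []) refl) (Eq-sym s)))
    ≋-trans (back {l′ = l″} z a b p q) (back z′ c d r s) =
      ⊥-elim (separated _ l″ (unseparated c d a b s p))

    snoc : ∀ {i e h} → e ∈ γ i → h ⊑ γ i → h ++ e ∷ [] ⊑ γ i
    snoc e∈γ p = ⊑-++ p (e∈γ ∷ [])

    ≋-snoc : ∀ {e i l h p i′ l′ h′ p′ q q′} → e ∈ γ i → e ∈ γ i′ → pt i l h p ≋ pt i′ l′ h′ p′ →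
      pt i l (h ++ e ∷ []) q ≋ pt i′ l′ (h′ ++ e ∷ []) q′
    ≋-snoc a b (same p) = same (Eq-++ p Eq-refl)
    ≋-snoc {e} a b (forth z c d p q) = forth (z ++ e ∷ []) (snoc a c) (snoc b d)
      (Eq-trans (Eq-++ p Eq-refl) (Eq-reflexive (Listₚ.++-assoc (w _) z _))) (Eq-++ q Eq-refl)
    ≋-snoc {e} a b (back z c d p q) = back (z ++ e ∷ []) (snoc b c) (snoc a d)
      (Eq-trans (Eq-++ p Eq-refl) (Eq-reflexive (Listₚ.++-assoc (w _) z _))) (Eq-++ q Eq-refl)

    Moves : Fin m → Point → Point → Set
    Moves e x y = ∃[ i ] ∃[ l ] ∃[ h ] ∃[ p ] ∃[ p′ ]
      (e ∈ γ i × ¬ ¬ (x ≋ pt i l h p) × ¬ ¬ (pt i l (h ++ e ∷ []) p′ ≋ y))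

    ≋-trans² : ∀ {x y z} → ¬ ¬ (x ≋ y) → ¬ ¬ (y ≋ z) → ¬ ¬ (x ≋ z)
    ≋-trans² p q = p >>= λ a → q >>= λ b → return (≋-trans a b)

    ≋-sym² : ∀ {x y} → ¬ ¬ (x ≋ y) → ¬ ¬ (y ≋ x)
    ≋-sym² p = p >>= λ a → return (≋-sym a)

    chain : Graph m
    chain = record
      { Vertex = Point
      ; _~_ = λ x y → ¬ ¬ (x ≋ y)
      ; ~refl = return (same Eq-refl)
      ; ~sym = ≋-sym²
      ; ~trans = ≋-trans²
      ; ~stable = λ p → p >>= id
      ; Move = Moves
      ; move-resp = λ { p q (i , l , h , r , r′ , e∈ , a , b) →
          i , l , h , r , r′ , e∈ , ≋-trans² (≋-sym² p) a , ≋-trans² b q }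
      ; move-sym = λ { {e} (i , l , h , r , r′ , e∈ , a , b) →
          i , l , h ++ e ∷ [] , r′ , snoc e∈ r′ , e∈ , ≋-sym² b ,
          ≋-trans² (return (same (rewriting (h ∷ (e ∷ []) ∷ []) ((v₀ ⊕ v₁) ⊕ v₁) v₀
            (rw v₀ (v₁ ⊕ v₁) ∅ (Eq-cancelʳ (e ∷ [])) ∷ []) refl))) (≋-sym² a) }
      ; move-functional = λ { (i , l , h , r , r′ , e∈ , a , b) (i₁ , l₁ , h₁ , r₁ , r₁′ , e∈₁ , a₁ , b₁) →
          ≋-trans² (≋-sym² b) (≋-trans²
            (≋-trans² (≋-sym² a) a₁ >>= λ p → return (≋-snoc e∈ e∈₁ p)) b₁) } }

    open Graph chain hiding (Vertex)
    open Locality bd bd-mono chain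

    -- The development of the chain into the group of level k. Moves along β change it by elements
    -- of ⟨β⟩, which is how a β-component is compared with a single coset.
    label : Point → Word m
    label (pt i l h p) = prefixWord w i ++ h

    label-≋ : ∀ {x y} → x ≋ y → label x ≈ label y
    label-≋ (same p) = Eq-++ Eq-refl p
    label-≋ (forth {i} {h = h} {h′} z _ _ p q) =
      rewriting (prefixWord w i ∷ w i ∷ h ∷ h′ ∷ z ∷ []) (v₀ ⊕ v₂) ((v₀ ⊕ v₁) ⊕ v₃)
        (rw v₀ v₂ (v₁ ⊕ v₄) p ∷ rw (v₀ ⊕ v₁) v₄ v₃ (Eq-sym q) ∷ []) refl
    label-≋ (back {l = l} {l′} {p = r} {r′} z a b p q) =
      Eq-sym (label-≋ (forth {l = l} {l′} {p = r} {r′} z a b p q))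

    label-~ : ∀ {x y} → x ~ y → label x ≈ label y
    label-~ p = Eq-stable (p >>= λ q → return (label-≋ q))

    label-move : ∀ {e x y} → Move e x y → label y ≈ label x ++ e ∷ []
    label-move {e} {x} {y} (i , l , h , r , r′ , e∈ , a , b) =
      rewriting (label x ∷ label y ∷ prefixWord w i ∷ h ∷ (e ∷ []) ∷ []) v₁ (v₀ ⊕ v₄)
        (rw ∅ v₁ (v₂ ⊕ v₃ ⊕ v₄) (Eq-sym (label-~ b)) ∷ rw ∅ (v₂ ⊕ v₃) v₀ (Eq-sym (label-~ a)) ∷ []) refl

    label-reach : ∀ {β x y} → Reach β x y → ∃[ v ] (v ⊑ β × label y ≈ label x ++ v)
    label-reach {β} {x} (u , u⊑β , p) =
      path-invariant (λ y → ∃[ v ] (v ⊑ β × label y ≈ label x ++ v))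
        (λ { q (v , v⊑β , r) → v , v⊑β , Eq-trans (Eq-sym (label-~ q)) r })
        (λ { {e} e∈β mv (v , v⊑β , r) → v ++ e ∷ [] , ⊑-++ v⊑β (e∈β ∷ []) ,
             Eq-trans (label-move mv) (Eq-trans (Eq-++ r Eq-refl) (Eq-reflexive (Listₚ.++-assoc (label x) v _))) })
        u⊑β p ([] , [] , Eq-reflexive (sym (Listₚ.++-identityʳ _)))

    word-path : ∀ {i l h p} v → v ⊑ γ i → ∀ q → Path v (pt i l h p) (pt i l (h ++ v) q)
    word-path {h = h} [] [] q = return (same (Eq-reflexive (sym (Listₚ.++-identityʳ h))))
    word-path {i} {l} {h} {p} (e ∷ v) (e∈ ∷ v⊑) q =
      pt i l (h ++ e ∷ []) (snoc e∈ p) ,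
      inj₁ (i , l , h , p , snoc e∈ p , e∈ , ~refl , ~refl) ,
      path-respʳ v (return (same (Eq-reflexive (Listₚ.++-assoc h _ v))))
        (word-path v v⊑ (⊑-++ (snoc e∈ p) v⊑))

    free-piece : ∀ {β} x → β ⊆ γ (idx x) → Free k β x
    free-piece (pt i l h p) β⊆γ v v⊑β v≈ z pz = ~trans
      (return (same (rewriting (h ∷ v ∷ []) v₀ (v₀ ⊕ v₁) (rw v₀ ∅ v₁ (Eq-sym v≈) ∷ []) refl)))
      (path-functional v (word-path v v⊑γ (⊑-++ p v⊑γ)) pz)
      where
      v⊑γ : v ⊑ γ i
      v⊑γ = ⊑-mono β⊆γ v⊑β

    -- By label-reach, a β-component meets piece i in a single coset of ⟨γ i ∩ β⟩.  When β ⊈ γ i this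
    -- is a subgroup of lower level, whose elements have short representatives.
    module Covered (j : ℕ) (j<k : suc j ≤ k) (β : Subset m) (β≡ : ∣ β ∣ ≡ suc j) (x : Point)
      (incomplete : ∀ y → Reach β x y → ¬ (β ⊆ γ (idx y)))
      (base? : ∀ (a : Fin N) → Dec (∃[ y ] (Reach β x y × idx y ≡ toℕ a))) where

      BaseAt : Fin N → Set
      BaseAt a = ∃[ y ] (Reach β x y × idx y ≡ toℕ a)

      NameAt : (a : Fin N) → Dec (BaseAt a) → Word m → Point → Set
      NameAt a (yes (b , _)) v y = ∃[ q ] (y ~ pt (idx b) (idx<n b) (word b ++ v) q)
      NameAt a (no _) v y = Empty

      nameAt-functional : ∀ a v {y z} (d : Dec (BaseAt a)) → NameAt a d v y → NameAt a d v z → y ~ z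
      nameAt-functional a v (yes _) (_ , p) (_ , q) = ~trans p (~trans (return (same Eq-refl)) (~sym q))

      same-piece : ∀ b y → Reach β x b → Reach β x y → idx b ≡ idx y →
        ∃[ r ] ∃[ q ] (y ~ pt (idx b) (idx<n b) (word b ++ rep (bd j) r) q)
      same-piece (pt i l h p) (pt .i l′ h′ p′) rb ry refl with label-reach rb | label-reach ry
      ... | v , v⊑β , lv | v′ , v′⊑β , lv′ = r , ⊑-++ p (⊑-∩ʳ r⊑) , return (same
          (rewriting (h ∷ h′ ∷ rep (bd j) r ∷ difference ↾ β ∷ []) v₁ (v₀ ⊕ v₂)
            (rw v₀ ((⊖ v₀) ⊕ v₁) v₃ (Eq-meet difference≈ (⊑-++ (⊑-inv v⊑β) v′⊑β)) ∷
             rw v₀ v₃ v₂ (Eq-sym r≈) ∷ []) refl))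
        where
        difference : Word m
        difference = inv h ++ h′
        difference≈ : difference ≈ inv v ++ v′
        difference≈ = rewriting (h ∷ h′ ∷ v ∷ v′ ∷ prefixWord w i ∷ label x ∷ [])
          ((⊖ v₀) ⊕ v₁) ((⊖ v₂) ⊕ v₃)
          (rw ((⊖ v₀) ⊕ (⊖ v₄)) (v₄ ⊕ v₁) (v₅ ⊕ v₃) lv′ ∷
           rw ((⊖ v₀) ⊕ (⊖ v₄)) (v₅ ⊕ v₂) (v₄ ⊕ v₀) (Eq-sym lv) ∷ []) refl
        D⊑ : difference ↾ β ⊑ β ∩ γ i
        D⊑ = ⊑-∩ (↾-⊑ difference β) (↾-keeps β (⊑-++ (⊑-inv p) p′))
        short = short-rep bd (bd j) j D⊑
        r = proj₁ short
        r⊑ = proj₁ (proj₂ short)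
        βγ≤j : ∣ β ∩ γ i ∣ ≤ j
        βγ≤j = ℕₚ.≤-pred (subst (∣ β ∩ γ i ∣ <_) β≡ (∩-< (incomplete _ ry)))
        r≈ : rep (bd j) r ≈ difference ↾ β
        r≈ = Eq-up (ℕₚ.<⇒≤ j<k) βγ≤j r⊑ D⊑ (proj₂ (proj₂ short))

      bounded : Bounded (N * reps {m} (bd j)) β x
      bounded = record
        { Names = Names
        ; names-functional = λ {c} {y} {z} → functional c {y} {z}
        ; named = named }
        where
        split : Fin (N * reps {m} (bd j)) → Fin N × Fin (reps {m} (bd j))
        split = remQuot {N} (reps {m} (bd j))
        NameOf : Fin N × Fin (reps {m} (bd j)) → Point → Set
        NameOf (a , r) = NameAt a (base? a) (rep (bd j) r)
        Names : Fin (N * reps {m} (bd j)) → Point → Set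
        Names c = NameOf (split c)
        functional : ∀ c {y z} → Names c y → Names c z → y ~ z
        functional c = nameAt-functional (proj₁ (split c)) (rep (bd j) (proj₂ (split c))) (base? (proj₁ (split c)))
        nameAt : ∀ a (d : Dec (BaseAt a)) y → Reach β x y → idx y ≡ toℕ a → ∃[ r ] NameAt a d (rep (bd j) r) y
        nameAt a (yes (b , rb , ib)) y ry iy = same-piece b y rb ry (trans ib (sym iy))
        nameAt a (no ¬b) y ry iy = ⊥-elim (¬b (y , ry , iy))
        named : ∀ {y} → Reach β x y → ¬ ¬ (∃[ c ] Names c y)
        named {y} ry = return (combine a (proj₁ name) , subst
          (λ c → NameOf c y)
          (sym (Finₚ.remQuot-combine a (proj₁ name))) (proj₂ name))
          where
          a : Fin N
          a = fromℕ< (ℕₚ.<-≤-trans (idx<n y) n≤N)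
          name : ∃[ r ] NameAt a (base? a) (rep (bd j) r) y
          name = nameAt a (base? a) y ry (sym (Finₚ.toℕ-fromℕ< (ℕₚ.<-≤-trans (idx<n y) n≤N)))

    chain-local : ∀ β → β ⊆ ⊤ → ∣ β ∣ ≤ k → ∀ x → ¬ ¬ (Free k β x ⊎ Bounded (bd ∣ β ∣) β x)
    chain-local β _ β≤k x = do
      no incomplete ← em {A = ∃[ y ] (Reach β x y × β ⊆ γ (idx y))}
        where yes (y , r , β⊆γ) → return (inj₁ (free-transport r (free-piece y β⊆γ)))
      base? ← ¬¬-Fin λ a → em {A = ∃[ y ] (Reach β x y × idx y ≡ toℕ a)}
      return (inj₂ (bounded-at ∣ β ∣ refl (λ y r β⊆γ → incomplete (y , r , β⊆γ)) base?))
      where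
      bounded-at : ∀ j → ∣ β ∣ ≡ j → (∀ y → Reach β x y → ¬ (β ⊆ γ (idx y))) →
        (∀ (a : Fin N) → Dec (∃[ y ] (Reach β x y × idx y ≡ toℕ a))) → Bounded (bd j) β x
      bounded-at zero β≡ incomplete base? = ⊥-elim (ℕₚ.n≮0 (subst (∣ β ∩ γ (idx x) ∣ <_) β≡
        (∩-< (incomplete x (reach-refl ~refl)))))
      bounded-at (suc j) β≡ incomplete base? = widen (ℕₚ.≤-trans (pieces≤mid j) (mid≤bd j))
        (Covered.bounded j (subst (_≤ k) β≡ β≤k) β β≡ x incomplete base?)

    chain-admissible : Transfer.GraphAdmissible bd chain (suc k)
    chain-admissible = local-admissible {α = ⊤} (λ _ → Subₚ.∈⊤) chain-local

    chain-bounded : ∀ x → Bounded (N * reps {m} (bd k)) ⊤ x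
    chain-bounded x = record { Names = Names ; names-functional = functional ; named = λ {y} _ → named y }
      where
      NameAt : Fin N × Fin (reps {m} (bd k)) → Point → Set
      NameAt (a , r) y = ∃[ l ] ∃[ q ] (y ~ pt (toℕ a) l (rep (bd k) r) q)
      Names : Fin (N * reps {m} (bd k)) → Point → Set
      Names c = NameAt (remQuot {N} (reps {m} (bd k)) c)
      functional : ∀ {c y z} → Names c y → Names c z → y ~ z
      functional (_ , _ , p) (_ , _ , q) = ~trans p (~trans (return (same Eq-refl)) (~sym q))
      named : ∀ y → ¬ ¬ (∃[ c ] Names c y)
      named (pt i l h p) with short-rep bd (bd k) k p
      ... | r , r⊑ , r≈ = return (combine a r ,
        subst (λ c → NameAt c (pt i l h p)) (sym (Finₚ.remQuot-combine a r)) at)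
        where
        a : Fin N
        a = fromℕ< (ℕₚ.<-≤-trans l n≤N)
        moved : ∀ i′ → i ≡ i′ → ∃[ l′ ] ∃[ q ] (pt i l h p ~ pt i′ l′ (rep (bd k) r) q)
        moved .i refl = l , r⊑ , return (same (Eq-sym r≈))
        at : NameAt (a , r) (pt i l h p)
        at = moved (toℕ a) (sym (Finₚ.toℕ-fromℕ< (ℕₚ.<-≤-trans l n≤N)))

    start : 0 < n → Point
    start l = pt 0 l [] []

    chain-path : ∀ (0<n : 0 < n) i (l : i < n) → Path (prefixWord w i) (start 0<n) (pt i l [] [])
    chain-path 0<n zero l = return (same Eq-refl)
    chain-path 0<n (suc i) l = path-++ (prefixWord w i) (chain-path 0<n i (ℕₚ.<⇒≤ l))
      (path-respʳ (w i) (return (forth [] [] [] (Eq-reflexive (sym (Listₚ.++-identityʳ (w i)))) Eq-refl))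
        (word-path (w i) (w⊑γ i) (w⊑γ i)))

    not-closed : ∀ {i l l₀ h p} → ¬ (pt (suc (suc i)) l h p ≋ pt 0 l₀ [] [])
    not-closed ()

    -- The chain is left open: from three pieces on, the last is not glued to the first. The product
    -- leads from the first piece into the last, so it cannot act trivially.
    contradictory : 3 ≤ n → ¬ Eq (mid k) (suc k) (prefixWord w n) []
    contradictory (s≤s {n = n′} (s≤s (s≤s _))) closed =
      Transfer.transfer bd chain chain-admissible (start (s≤s z≤n)) Names names-functional
        (λ {v} p → named (v , ⊑-⊤ v , p)) closed
        (path-++ (prefixWord w n′) (chain-path (s≤s z≤n) n′ ℕₚ.≤-refl) (word-path (w n′) (w⊑γ n′) (w⊑γ n′)))
        ~refl not-closed
      where open Bounded (widen (pieces≤mid k) (chain-bounded (start (s≤s z≤n))))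

  cycle-unseparated : ∀ n → 3 ≤ n → n ≤ N → Eq (mid k) (suc k) (prefixWord w n) [] →
    ¬ ¬ (∃[ i ] (suc (suc i) < n × Unseparated i))
  cycle-unseparated n 3≤n n≤N closed none =
    Amalgam.contradictory n n≤N (λ i l u → none (i , l , u)) 3≤n closed

-- `pieces≤mid` covers the points of a chain, `reps≤mid` the arms around a hub, `pairs≤bd` the
-- points of a completion, each given by a base and a word.
record Growth (m N : ℕ) : Set where
  field
    bd mid : ℕ → ℕ
    bd≤mid : ∀ k → bd k ≤ mid k
    mid≤bd : ∀ k → mid k ≤ bd (suc k)
    pieces≤mid : ∀ k → N * reps {m} (bd k) ≤ mid k
    reps≤mid : ∀ k → reps {m} (bd k) ≤ mid k
    pairs≤bd : ∀ k → reps {m} (mid k) * reps {m} (mid k) ≤ bd (suc k)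
    4≤N : 4 ≤ N

  bd-mono : ∀ k → bd k ≤ bd (suc k)
  bd-mono k = ℕₚ.≤-trans (bd≤mid k) (mid≤bd k)

-- Closed products of at most four small elements

module SmallProducts {m N : ℕ} (growth : Growth m N) (k : ℕ) where
  open Growth growth
  open Tower {m} bd
  open Monotone bd-mono

  infix 4 _≈_ _≈′_
  _≈_ _≈′_ : Word m → Word m → Set
  _≈_ = Eq (bd k) k
  _≈′_ = Eq (mid k) (suc k)

  ≈′⇒≈ : ∀ {u v} → u ≈′ v → u ≈ v
  ≈′⇒≈ = Eq-down₁ k (bd≤mid k)

  Splits : Word m → Subset m → Subset m → Subset m → Set
  Splits x α β γ = ∃[ v ] ∃[ v′ ] (v ⊑ α × v ⊑ β × v′ ⊑ β × v′ ⊑ γ × x ≈ v ++ v′)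

  -- The chain argument with four pieces; the side that splits is an inner one, as the chain is
  -- open.
  four-cycle : ∀ {γ₁ γ₂ γ₃ γ₄ x₁ x₂ x₃ x₄} → ∣ γ₁ ∣ ≤ k → ∣ γ₂ ∣ ≤ k → ∣ γ₃ ∣ ≤ k → ∣ γ₄ ∣ ≤ k →
    x₁ ⊑ γ₁ → x₂ ⊑ γ₂ → x₃ ⊑ γ₃ → x₄ ⊑ γ₄ → x₁ ++ x₂ ++ x₃ ++ x₄ ≈′ [] →
    ¬ ¬ (Splits x₂ γ₁ γ₂ γ₃ ⊎ Splits x₃ γ₂ γ₃ γ₄)
  four-cycle {γ₁} {γ₂} {γ₃} {γ₄} {x₁} {x₂} {x₃} {x₄} s₁ s₂ s₃ s₄ p₁ p₂ p₃ p₄ closed = do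
    i , l , unseparated ← Chain.cycle-unseparated bd bd-mono mid N mid≤bd pieces≤mid k γ γ≤k w w⊑γ 4
      (s≤s (s≤s (s≤s z≤n))) 4≤N
      (rewriting (x₁ ∷ x₂ ∷ x₃ ∷ x₄ ∷ []) ((((∅ ⊕ v₀) ⊕ v₁) ⊕ v₂) ⊕ v₃) ∅
        (rw ∅ (v₀ ⊕ v₁ ⊕ v₂ ⊕ v₃) ∅ closed ∷ []) refl)
    return (result i l unseparated)
    where
    open GroupSolver (Eq-group (mid k) (suc k))
    γ : ℕ → Subset m
    γ 0 = γ₁
    γ 1 = γ₂
    γ 2 = γ₃
    γ (suc (suc (suc _))) = γ₄
    γ≤k : ∀ i → ∣ γ i ∣ ≤ k
    γ≤k 0 = s₁
    γ≤k 1 = s₂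
    γ≤k 2 = s₃
    γ≤k (suc (suc (suc _))) = s₄
    w : ℕ → Word m
    w 0 = x₁
    w 1 = x₂
    w 2 = x₃
    w (suc (suc (suc _))) = x₄
    w⊑γ : ∀ i → w i ⊑ γ i
    w⊑γ 0 = p₁
    w⊑γ 1 = p₂
    w⊑γ 2 = p₃
    w⊑γ (suc (suc (suc _))) = p₄
    result : ∀ i → suc (suc i) < 4 → Splits (w (suc i)) (γ i) (γ (suc i)) (γ (suc (suc i))) →
      Splits x₂ γ₁ γ₂ γ₃ ⊎ Splits x₃ γ₂ γ₃ γ₄
    result 0 _ s = inj₁ s
    result 1 _ s = inj₂ s
    result (suc (suc i)) (s≤s (s≤s (s≤s (s≤s ())))) s

  module _ (M : ℕ) where
    open GroupSolver (Eq-group M (suc k))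
    private module S′ = GroupSolver (Eq-group (mid k) (suc k))

    infix 4 _≋_
    _≋_ : Word m → Word m → Set
    _≋_ = Eq M (suc k)

    transport : ∀ {u v γ} → ∣ γ ∣ ≤ k → u ⊑ γ → v ⊑ γ → u ≈′ v → u ≋ v
    transport γ≤k p q u≈v = Eq-up₁ M γ≤k p q (≈′⇒≈ u≈v)

    -- Both x₁ and x₂⁻¹ equal `x₁ ↾ γ₂`. The first equality lives in ⟨γ₁⟩ and the second in ⟨γ₂⟩,
    -- where the bound makes no difference.
    two-product : ∀ {γ₁ γ₂ x₁ x₂} → ∣ γ₁ ∣ ≤ k → ∣ γ₂ ∣ ≤ k → x₁ ⊑ γ₁ → x₂ ⊑ γ₂ →
      x₁ ++ x₂ ≈′ [] → x₁ ++ x₂ ≋ []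
    two-product {γ₁} {γ₂} {x₁} {x₂} s₁ s₂ p₁ p₂ closed =
      rewriting (x₁ ∷ x₂ ∷ x₁ ↾ γ₂ ∷ []) (v₀ ⊕ v₁) ∅
        (rw ∅ v₀ v₂ (transport s₁ p₁ (↾-keeps γ₂ p₁) x₁≈) ∷
         rw ∅ v₂ (⊖ v₁) (transport s₂ (↾-⊑ x₁ γ₂) (⊑-inv p₂) (Eq-trans (Eq-sym x₁≈) x₁≈x₂⁻¹)) ∷ []) refl
      where
      x₁≈x₂⁻¹ : x₁ ≈′ inv x₂
      x₁≈x₂⁻¹ = S′.rewriting (x₁ ∷ x₂ ∷ []) v₀ (⊖ v₁)
        (S′.rw ∅ (v₀ ⊕ v₁) ∅ closed ∷ []) refl
      x₁≈ : x₁ ≈′ x₁ ↾ γ₂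
      x₁≈ = Eq-meet x₁≈x₂⁻¹ (⊑-inv p₂)

    -- Retracting the relation onto ⟨γ₂⟩ expresses x₂ inside ⟨γ₂⟩ by the retracts of its neighbours.
    -- Substituting this leaves a product of one element of ⟨γ₁⟩ and one of ⟨γ₃⟩.
    three-product : ∀ {γ₁ γ₂ γ₃ x₁ x₂ x₃} → ∣ γ₁ ∣ ≤ k → ∣ γ₂ ∣ ≤ k → ∣ γ₃ ∣ ≤ k →
      x₁ ⊑ γ₁ → x₂ ⊑ γ₂ → x₃ ⊑ γ₃ → x₁ ++ x₂ ++ x₃ ≈′ [] → x₁ ++ x₂ ++ x₃ ≋ []
    three-product {γ₁} {γ₂} {γ₃} {x₁} {x₂} {x₃} s₁ s₂ s₃ p₁ p₂ p₃ closed =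
      rewriting (x₁ ∷ x₂ ∷ x₃ ∷ y₁ ∷ y₃ ∷ []) (v₀ ⊕ v₁ ⊕ v₂) ∅
        (rw v₀ v₁ ((⊖ v₃) ⊕ (⊖ v₄)) (transport s₂ p₂ (⊑-++ (⊑-inv (↾-⊑ x₁ γ₂)) (⊑-inv (↾-⊑ x₃ γ₂))) x₂≈) ∷
         rw ∅ ((v₀ ⊕ (⊖ v₃)) ⊕ ((⊖ v₄) ⊕ v₂)) ∅
           (two-product s₁ s₃ (⊑-++ p₁ (⊑-inv (↾-keeps γ₂ p₁))) (⊑-++ (⊑-inv (↾-keeps γ₂ p₃)) p₃)
             (S′.rewriting (x₁ ∷ x₂ ∷ x₃ ∷ y₁ ∷ y₃ ∷ [])
               ((v₀ ⊕ (⊖ v₃)) ⊕ ((⊖ v₄) ⊕ v₂)) ∅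
               (S′.rw v₀ ((⊖ v₃) ⊕ (⊖ v₄)) v₁ (Eq-sym x₂≈) ∷
                S′.rw ∅ (v₀ ⊕ v₁ ⊕ v₂) ∅ closed ∷ []) refl)) ∷ []) refl
      where
      y₁ = x₁ ↾ γ₂
      y₃ = x₃ ↾ γ₂
      restricted : y₁ ++ x₂ ++ y₃ ≈′ []
      restricted = Eq-trans (Eq-reflexive (sym (trans (↾-++ x₁ (x₂ ++ x₃) γ₂)
        (cong (y₁ ++_) (trans (↾-++ x₂ x₃ γ₂) (cong (_++ y₃) (↾-id p₂))))))) (Eq-↾ (suc k) γ₂ closed)
      x₂≈ : x₂ ≈′ inv y₁ ++ inv y₃
      x₂≈ = S′.rewriting (x₂ ∷ y₁ ∷ y₃ ∷ []) v₀ ((⊖ v₁) ⊕ (⊖ v₂))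
        (S′.rw (⊖ v₁) (v₁ ⊕ v₀ ⊕ v₂) ∅ restricted ∷ []) refl

    -- An inner side splits by `four-cycle`; its neighbours absorb the two halves and three factors
    -- remain.
    four-product : ∀ {γ₁ γ₂ γ₃ γ₄ x₁ x₂ x₃ x₄} → ∣ γ₁ ∣ ≤ k → ∣ γ₂ ∣ ≤ k → ∣ γ₃ ∣ ≤ k → ∣ γ₄ ∣ ≤ k →
      x₁ ⊑ γ₁ → x₂ ⊑ γ₂ → x₃ ⊑ γ₃ → x₄ ⊑ γ₄ → x₁ ++ x₂ ++ x₃ ++ x₄ ≈′ [] →
      x₁ ++ x₂ ++ x₃ ++ x₄ ≋ []
    four-product {γ₁} {γ₂} {γ₃} {γ₄} {x₁} {x₂} {x₃} {x₄} s₁ s₂ s₃ s₄ p₁ p₂ p₃ p₄ closed =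
      Eq-stable (four-cycle s₁ s₂ s₃ s₄ p₁ p₂ p₃ p₄ closed >>= λ r → return (merged r))
      where
      up : ∀ {M′ u v γ} → ∣ γ ∣ ≤ k → u ⊑ γ → v ⊑ γ → u ≈ v → Eq M′ (suc k) u v
      up {M′} = Eq-up₁ M′
      merged : Splits x₂ γ₁ γ₂ γ₃ ⊎ Splits x₃ γ₂ γ₃ γ₄ → x₁ ++ x₂ ++ x₃ ++ x₄ ≋ []
      merged (inj₁ (v , v′ , a , b , c , d , x₂≈)) =
        rewriting (x₁ ∷ x₂ ∷ x₃ ∷ x₄ ∷ v ∷ v′ ∷ []) (v₀ ⊕ v₁ ⊕ v₂ ⊕ v₃) ∅
          (rw v₀ v₁ (v₄ ⊕ v₅) (up s₂ p₂ (⊑-++ b c) x₂≈) ∷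
           rw ∅ ((v₀ ⊕ v₄) ⊕ (v₅ ⊕ v₂) ⊕ v₃) ∅
            (three-product s₁ s₃ s₄ (⊑-++ p₁ a) (⊑-++ d p₃) p₄
              (S′.rewriting (x₁ ∷ x₂ ∷ x₃ ∷ x₄ ∷ v ∷ v′ ∷ [])
                ((v₀ ⊕ v₄) ⊕ (v₅ ⊕ v₂) ⊕ v₃) ∅
                (S′.rw v₀ (v₄ ⊕ v₅) v₁ (Eq-sym (up s₂ p₂ (⊑-++ b c) x₂≈)) ∷
                 S′.rw ∅ (v₀ ⊕ v₁ ⊕ v₂ ⊕ v₃) ∅ closed ∷ []) refl)) ∷ []) refl
      merged (inj₂ (v , v′ , a , b , c , d , x₃≈)) =
        rewriting (x₁ ∷ x₂ ∷ x₃ ∷ x₄ ∷ v ∷ v′ ∷ []) (v₀ ⊕ v₁ ⊕ v₂ ⊕ v₃) ∅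
          (rw (v₀ ⊕ v₁) v₂ (v₄ ⊕ v₅) (up s₃ p₃ (⊑-++ b c) x₃≈) ∷
           rw ∅ (v₀ ⊕ (v₁ ⊕ v₄) ⊕ (v₅ ⊕ v₃)) ∅
            (three-product s₁ s₂ s₄ p₁ (⊑-++ p₂ a) (⊑-++ d p₄)
              (S′.rewriting (x₁ ∷ x₂ ∷ x₃ ∷ x₄ ∷ v ∷ v′ ∷ [])
                (v₀ ⊕ (v₁ ⊕ v₄) ⊕ (v₅ ⊕ v₃)) ∅
                (S′.rw (v₀ ⊕ v₁) (v₄ ⊕ v₅) v₂ (Eq-sym (up s₃ p₃ (⊑-++ b c) x₃≈)) ∷
                 S′.rw ∅ (v₀ ⊕ v₁ ⊕ v₂ ⊕ v₃) ∅ closed ∷ []) refl)) ∷ []) refl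

-- Completions of walk cosets

module Walks {m n : ℕ} (I : EGraph m n) where
  open EGraph I hiding (sym)

  walk-++ : ∀ {α s u r v t} → Walk α s u r → Walk α r v t → Walk α s (u ++ v) t
  walk-++ nil q = q
  walk-++ (cons e∈ r p) q = cons e∈ r (walk-++ p q)

  walk-inv : ∀ {α s u t} → Walk α s u t → Walk α t (inv u) s
  walk-inv nil = nil
  walk-inv (cons e∈ r p) = walk-++ (walk-inv p) (cons e∈ (EGraph.sym I _ _ _ r) nil)

  walk-mono : ∀ {α β s u t} → α ⊆ β → Walk α s u t → Walk β s u t
  walk-mono α⊆β nil = nil
  walk-mono α⊆β (cons e∈ r p) = cons (α⊆β e∈) r (walk-mono α⊆β p)

  walk-⊑ : ∀ {α s u t} → Walk α s u t → u ⊑ α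
  walk-⊑ nil = []
  walk-⊑ (cons e∈ r p) = e∈ ∷ walk-⊑ p

  walk-split : ∀ {α s t} u {v} → Walk α s (u ++ v) t → ∃[ r ] (Walk α s u r × Walk α r v t)
  walk-split [] p = _ , nil , p
  walk-split (e ∷ u) (cons e∈ r p) with walk-split u p
  ... | _ , q , q′ = _ , cons e∈ r q , q′

  walk-end : ∀ {α s u t} → Walk α s u t → act π u s ≡ t
  walk-end nil = refl
  walk-end {u = e ∷ u} {t} (cons {s = s} e∈ r p) =
    subst (λ x → act π u (fromMaybe s x) ≡ t) (sym r) (walk-end p)

  walk-deterministic : ∀ {α β s u t t′} → Walk α s u t → Walk β s u t′ → t ≡ t′
  walk-deterministic p q = trans (sym (walk-end p)) (walk-end q)

  π-involutive : Involutive π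
  π-involutive e s with nbr e s in p
  ... | nothing rewrite p = refl
  ... | just t rewrite EGraph.sym I e s t p = refl

  Walks₃ : (Word m → Word m → Set) → (γ₁ γ₂ γ₃ : Subset m) → Fin n → Word m → Fin n → Set
  Walks₃ _≈_ γ₁ γ₂ γ₃ s u t = ∃[ u₁ ] ∃[ u₂ ] ∃[ u₃ ] ∃[ t₁ ] ∃[ t₂ ]
    (Walk γ₁ s u₁ t₁ × Walk γ₂ t₁ u₂ t₂ × Walk γ₃ t₂ u₃ t × u ≈ (u₁ ++ u₂ ++ u₃))

-- The factors x₁, x₂, x₃ of a walk may fail to label walks in I themselves. Convexity exchanges
-- them for factors over the same sets that do.
Convex : ∀ {m n N} → Growth m N → EGraph m n → ℕ → Subset m → Set
Convex {m} growth I k α = ∀ {s t u γ₁ γ₂ γ₃ x₁ x₂ x₃} → Walk α s u t → γ₁ ⊆ α → γ₂ ⊆ α → γ₃ ⊆ α →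
  x₁ ⊑ γ₁ → x₂ ⊑ γ₂ → x₃ ⊑ γ₃ → Eq (bd k) k u (x₁ ++ x₂ ++ x₃) →
  ¬ ¬ Walks.Walks₃ I (Eq (bd k) k) γ₁ γ₂ γ₃ s u t
  where
  open Growth growth
  open Tower {m} bd
  open EGraph I

module Completion {m n N : ℕ} (growth : Growth m N) (I : EGraph m n) (n≤bd : n ≤ Growth.bd growth 0)
  (k : ℕ) (α : Subset m) (α≡ : ∣ α ∣ ≡ suc k) (convex : ∀ δ → ∣ δ ∣ ≤ k → Convex growth I k δ)
  (s₀ : Fin n) where
  open Growth growth
  open Tower {m} bd
  open Monotone bd-mono
  open EGraph I hiding (sym)
  open Walks I
  open SmallProducts growth k
  open GroupSolver (Eq-group (mid k) (suc k))

  up : ∀ {u v γ} → ∣ γ ∣ ≤ k → u ⊑ γ → v ⊑ γ → u ≈ v → u ≈′ v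
  up = Eq-up₁ (mid k)

  convex′ : ∀ {δ s t u γ₁ γ₂ γ₃ x₁ x₂ x₃} → ∣ δ ∣ ≤ k → Walk δ s u t → γ₁ ⊆ δ → γ₂ ⊆ δ → γ₃ ⊆ δ →
    x₁ ⊑ γ₁ → x₂ ⊑ γ₂ → x₃ ⊑ γ₃ → u ≈′ x₁ ++ x₂ ++ x₃ → ¬ ¬ Walks₃ _≈′_ γ₁ γ₂ γ₃ s u t
  convex′ {δ} δ≤k w a b c p q r u≈ = do
    u₁ , u₂ , u₃ , t₁ , t₂ , w₁ , w₂ , w₃ , u≈′ ← convex δ δ≤k w a b c p q r (≈′⇒≈ u≈)
    return (u₁ , u₂ , u₃ , t₁ , t₂ , w₁ , w₂ , w₃ , up δ≤k (walk-⊑ w)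
      (⊑-++ (⊑-mono a (walk-⊑ w₁)) (⊑-++ (⊑-mono b (walk-⊑ w₂)) (⊑-mono c (walk-⊑ w₃)))) u≈′)

  convex₂ : ∀ {δ s t u γ₁ γ₂ x₁ x₂} → ∣ δ ∣ ≤ k → Walk δ s u t → γ₁ ⊆ δ → γ₂ ⊆ δ →
    x₁ ⊑ γ₁ → x₂ ⊑ γ₂ → u ≈′ x₁ ++ x₂ →
    ¬ ¬ (∃[ u₁ ] ∃[ u₂ ] ∃[ r ] (Walk γ₁ s u₁ r × Walk γ₂ r u₂ t × u ≈′ u₁ ++ u₂))
  convex₂ {u = u} {x₁ = x₁} {x₂} δ≤k w a b p q u≈ = do
    u₁ , u₂ , u₃ , t₁ , t₂ , w₁ , w₂ , w₃ , u≈′ ← convex′ {x₁ = x₁} {x₂} {[]} δ≤k w a b b p q []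
      (Eq-trans u≈ (Eq-reflexive (cong (x₁ ++_) (sym (Listₚ.++-identityʳ x₂)))))
    return (u₁ , u₂ ++ u₃ , t₁ , w₁ , walk-++ w₂ w₃ , u≈′)

  proper-witness : ∀ {γ} → ∣ γ ∣ ≤ k → ∃[ a ] (a ∈ α × a ∉ γ)
  proper-witness {γ} γ≤k = ⊈-witness λ α⊆γ →
    ℕₚ.1+n≰n (ℕₚ.≤-trans (subst (_≤ ∣ γ ∣) α≡ (Subₚ.p⊆q⇒∣p∣≤∣q∣ α⊆γ)) γ≤k)

  -- A point stands for base · word in the coset of ⟨γ⟩ attached to the walk coset at base.
  record Point : Set where
    constructor pt
    field
      {base} : Word m
      {state} : Fin n
      base-walk : Walk α s₀ base state
      {γ} : Subset m
      γ⊆α : γ ⊆ α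
      γ≤k : ∣ γ ∣ ≤ k
      {word} : Word m
      word⊑ : word ⊑ γ
  open Point

  Joined : Point → Point → Set
  Joined x y = ∃[ u ] ∃[ v ] ∃[ r ]
    (Walk (γ x) (state x) u r × Walk (γ y) (state y) v r × base x ++ u ≈′ base y ++ v)

  label : Point → Word m
  label x = base x ++ word x

  -- Points of equal label are identified if their cosets are attached at a common point of the walk coset.
  infix 4 _~_
  record _~_ (x y : Point) : Set where
    constructor _with-joint_
    field
      labels : label x ≈′ label y
      joint : ¬ ¬ Joined x y
  open _~_

  -- The base is the joint, and the sets γ of the two points may differ. A point can thus be viewed
  -- in a larger or a smaller coset at its base.
  same-base : ∀ {x y} → base x ≡ base y → word x ≈′ word y → x ~ y
  same-base {x@(pt w _ _ _)} {pt w′ _ _ _} refl p with walk-deterministic w w′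
  ... | refl = Eq-++ Eq-refl p with-joint return ([] , [] , _ , nil , nil , Eq-refl)

  ~sym : ∀ {x y} → x ~ y → y ~ x
  ~sym (p with-joint j) = Eq-sym p with-joint (j >>= λ { (u , v , r , a , b , q) → return (v , u , r , b , a , Eq-sym q) })

  meet-word : ∀ {x y} → x ~ y → ((u , v , r , _) : Joined x y) →
    inv u ++ word x ≈′ (inv u ++ word x) ↾ γ y ×
    (inv u ++ word x) ↾ γ y ⊑ γ x ∩ γ y
  meet-word {x} {y} (p with-joint _) (u , v , r , a , b , q) =
    Eq-meet (rewriting (u ∷ v ∷ word x ∷ word y ∷ base x ∷ base y ∷ []) ((⊖ v₀) ⊕ v₂) ((⊖ v₁) ⊕ v₃)
      (rw ((⊖ v₀) ⊕ (⊖ v₄)) (v₄ ⊕ v₂) (v₅ ⊕ v₃) p ∷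
       rw ((⊖ v₀) ⊕ (⊖ v₄)) (v₅ ⊕ v₁) (v₄ ⊕ v₀) (Eq-sym q) ∷ []) refl)
      (⊑-++ (⊑-inv (walk-⊑ b)) (word⊑ y)) ,
    ⊑-∩ (↾-keeps (γ y) (⊑-++ (⊑-inv (walk-⊑ a)) (word⊑ x))) (↾-⊑ (inv u ++ word x) (γ y))

  -- The two joints at y differ by the walk v⁻¹ u′ over γ y, which is a product of elements of ⟨γ x
  -- ∩ γ y⟩ and ⟨γ z ∩ γ y⟩. Convexity of γ y, a smaller set than α, divides it into walks c and d,
  -- along which both joints move to a common point.
  ~trans : ∀ {x y z} → x ~ y → y ~ z → x ~ z
  ~trans {x} {y} {z} xy@(p with-joint j) yz@(q with-joint j′) = Eq-trans p q with-joint do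
    J@(u , v , r , a , b , e) ← j
    J′@(u′ , v′ , r′ , a′ , b′ , e′) ← j′
    let h₁≈ , h₁⊑ = meet-word xy J
        h₂≈ , h₂⊑ = meet-word (~sym yz) (v′ , u′ , r′ , b′ , a′ , Eq-sym e′)
        h₁ = (inv u ++ word x) ↾ γ y
        h₂ = (inv v′ ++ word z) ↾ γ y
    c , d , r″ , wc , wd , f ← convex₂ {x₁ = h₁} {inv h₂} (γ≤k y) (walk-++ (walk-inv b) a′)
      (Subₚ.p∩q⊆q (γ x) (γ y)) (Subₚ.p∩q⊆q (γ z) (γ y)) h₁⊑ (⊑-inv h₂⊑)
      (rewriting (v ∷ u′ ∷ h₁ ∷ h₂ ∷ u ∷ word x ∷ v′ ∷ word z ∷ base x ∷ base y ∷ base z ∷ [])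
        ((⊖ v₀) ⊕ v₁) (v₂ ⊕ (⊖ v₃))
        (rw ((⊖ v₀) ⊕ (⊖ v₉)) (v₉ ⊕ v₁) (v₁₀ ⊕ v₆) e′ ∷
         rw ((⊖ v₀) ⊕ (⊖ v₉)) (v₈ ⊕ v₄) (v₉ ⊕ v₀) e ∷
         rw ((⊖ v₄) ⊕ (⊖ v₈)) (v₁₀ ⊕ v₇) (v₈ ⊕ v₅) (Eq-sym (Eq-trans p q)) ∷
         rw ∅ ((⊖ v₄) ⊕ v₅) v₂ h₁≈ ∷
         rw (v₂ ⊕ (⊖ v₇) ⊕ v₆) v₃ ((⊖ v₆) ⊕ v₇) (Eq-sym h₂≈) ∷ []) refl)
    return (u ++ c , v′ ++ inv d , r″ , walk-++ a (walk-mono (Subₚ.p∩q⊆p (γ x) (γ y)) wc) ,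
      walk-++ b′ (walk-inv (walk-mono (Subₚ.p∩q⊆p (γ z) (γ y)) wd)) ,
      rewriting (u ∷ v ∷ u′ ∷ v′ ∷ c ∷ d ∷ base x ∷ base y ∷ base z ∷ [])
        (v₆ ⊕ v₀ ⊕ v₄) (v₈ ⊕ v₃ ⊕ (⊖ v₅))
        (rw ∅ (v₆ ⊕ v₀) (v₇ ⊕ v₁) e ∷
         rw (v₇ ⊕ v₁) (v₄ ⊕ v₅) ((⊖ v₁) ⊕ v₂) (Eq-sym f) ∷
         rw ∅ (v₇ ⊕ v₂) (v₈ ⊕ v₃) e′ ∷ []) refl)

  snoc : ∀ (x : Point) {e} → e ∈ γ x → Point
  snoc (pt w a b c) e∈ = pt w a b (⊑-++ c (e∈ ∷ []))

  ~snoc : ∀ {x y e} (a : e ∈ γ x) (b : e ∈ γ y) → x ~ y → snoc x a ~ snoc y b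
  ~snoc {x} {y} a b (p with-joint j) =
    Eq-trans (Eq-reflexive (sym (Listₚ.++-assoc (base x) (word x) _)))
      (Eq-trans (Eq-++ p Eq-refl) (Eq-reflexive (Listₚ.++-assoc (base y) (word y) _)))
    with-joint j

  completion : Graph m
  completion = record
    { Vertex = Point
    ; _~_ = _~_
    ; ~refl = same-base refl Eq-refl
    ; ~sym = ~sym
    ; ~trans = ~trans
    ; ~stable = λ p → Eq-stable (p >>= λ q → return (labels q)) with-joint (p >>= joint)
    ; Move = λ e x y → ∃[ z ] Σ (e ∈ γ z) λ e∈ → x ~ z × snoc z e∈ ~ y
    ; move-resp = λ { p q (z , e∈ , a , b) → z , e∈ , ~trans (~sym p) a , ~trans b q }
    ; move-sym = λ { {e} (z , e∈ , a , b) → snoc z e∈ , e∈ , ~sym b ,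
        ~trans (same-base refl (rewriting (word z ∷ (e ∷ []) ∷ []) ((v₀ ⊕ v₁) ⊕ v₁) v₀
          (rw v₀ (v₁ ⊕ v₁) ∅ (Eq-cancelʳ (e ∷ [])) ∷ []) refl)) (~sym a) }
    ; move-functional = λ { (z , e∈ , a , b) (z′ , e∈′ , a′ , b′) →
        ~trans (~sym b) (~trans (~snoc e∈ e∈′ (~trans (~sym a) a′)) b′) } }

  open Graph completion hiding (Vertex; _~_; ~sym; ~trans)
  open Locality bd bd-mono completion

  extend : (x : Point) → ∀ v → v ⊑ γ x → Point
  extend x v v⊑ = pt (base-walk x) (γ⊆α x) (γ≤k x) (⊑-++ (word⊑ x) v⊑)

  word-path : ∀ x v (v⊑ : v ⊑ γ x) → Path v x (extend x v v⊑)
  word-path x [] [] = same-base refl (Eq-reflexive (sym (Listₚ.++-identityʳ (word x))))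
  word-path x (e ∷ v) (e∈ ∷ v⊑) = snoc x e∈ , inj₁ (x , e∈ , ~refl , ~refl) ,
    path-respʳ v (same-base refl (Eq-reflexive (Listₚ.++-assoc (word x) _ v))) (word-path (snoc x e∈) v v⊑)

  -- Take the joint as the new base; by `meet-word` the remaining word is over γ x ∩ γ y.
  common : ∀ {x y} → x ~ y → ¬ ¬ (∃[ z ] (z ~ x × γ z ≡ γ x ∩ γ y))
  common {x} {y} xy@(p with-joint j) = do
    J@(u , v , r , a , b , q) ← j
    let h≈ , h⊑ = meet-word xy J
    return (pt (walk-++ (base-walk x) (walk-mono (γ⊆α x) a))
      (λ e∈ → γ⊆α x (Subₚ.p∩q⊆p (γ x) (γ y) e∈)) (ℕₚ.≤-trans (Subₚ.∣p∩q∣≤∣p∣ (γ x) (γ y)) (γ≤k x)) h⊑ ,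
      (rewriting (u ∷ base x ∷ word x ∷ (inv u ++ word x) ↾ γ y ∷ []) ((v₁ ⊕ v₀) ⊕ v₃) (v₁ ⊕ v₂)
        (rw (v₁ ⊕ v₀) v₃ ((⊖ v₀) ⊕ v₂) (Eq-sym h≈) ∷ []) refl
       with-joint return ([] , u , r , nil , a , Eq-reflexive (Listₚ.++-identityʳ _))) , refl)

  -- The union γ x ∪ β still misses `a`, so its coset is also attached at the base of x.
  widened : ∀ {β a} x → β ⊆ α → a ∈ α → a ∉ γ x → a ∉ β → ∃[ y ] (x ~ y × β ⊆ γ y)
  widened {β} {a} x β⊆α a∈α a∉γ a∉β =
    pt (base-walk x) τ⊆α τ≤k (⊑-mono (Subₚ.p⊆p∪q β) (word⊑ x)) , same-base refl Eq-refl ,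
    Subₚ.q⊆p∪q (γ x) β
    where
    τ : Subset m
    τ = γ x ∪ β
    a∉τ : a ∉ τ
    a∉τ a∈ with Subₚ.x∈p∪q⁻ (γ x) β a∈
    ... | inj₁ p = a∉γ p
    ... | inj₂ p = a∉β p
    τ⊆α : τ ⊆ α
    τ⊆α e∈ with Subₚ.x∈p∪q⁻ (γ x) β e∈
    ... | inj₁ p = γ⊆α x p
    ... | inj₂ p = β⊆α p
    τ≤k : ∣ τ ∣ ≤ k
    τ≤k = ℕₚ.≤-pred (subst (∣ τ ∣ <_) α≡ (Subₚ.p⊂q⇒∣p∣<∣q∣ (τ⊆α , a , a∈α , a∉τ)))

  free-wide : ∀ {β} x → ∣ β ∣ ≤ k → β ⊆ γ x → Free k β x
  free-wide x β≤k β⊆γ w w⊑β w≈ y p = ~trans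
    (same-base refl (rewriting (word x ∷ w ∷ []) v₀ (v₀ ⊕ v₁) (rw v₀ ∅ v₁ (Eq-sym (up β≤k w⊑β [] w≈)) ∷ []) refl))
    (path-functional w (word-path x w (⊑-mono β⊆γ w⊑β)) p)

  -- What is left when `widened` never applies: throughout the component γ y and β together exhaust
  -- α. The component is then centred at a point ζ with the fewest letters in γ.
  record Hub (β : Subset m) (x : Point) : Set where
    field
      ζ : Point
      reach-ζ : Reach β x ζ
      narrow : ∀ {y} → Reach β ζ y → ∀ {a} → a ∈ α → a ∉ γ y → a ∈ β
      minimal : ∀ {y} → Reach β ζ y → ∣ γ ζ ∣ ≤ ∣ γ y ∣

  dichotomy : ∀ {β} → β ⊆ α → ∀ x → ¬ ¬ ((∃[ y ] (Reach β x y × β ⊆ γ y)) ⊎ Hub β x)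
  dichotomy {β} β⊆α x = do
    no narrow ← em {A = ∃[ y ] ∃[ a ] (Reach β x y × a ∈ α × a ∉ γ y × a ∉ β)}
      where yes (y , a , r , a∈α , a∉γ , a∉β) →
              let z , y~z , β⊆γ = widened y β⊆α a∈α a∉γ a∉β
              in return (inj₁ (z , reach-trans r (reach-refl y~z) , λ {e} e∈ → β⊆γ e∈))
    ζ , r , minimal ← smallest ∣ γ x ∣ x ℕₚ.≤-refl (reach-refl ~refl)
    return (inj₂ (record
      { ζ = ζ ; reach-ζ = r
      ; narrow = λ {y} r′ {a} a∈α a∉γ → decidable-stable (a Subₚ.∈? β) λ a∉β →
          narrow (y , a , reach-trans r r′ , a∈α , a∉γ , a∉β)
      ; minimal = λ r′ → minimal _ (reach-trans r r′) }))
    where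
    Least : Set
    Least = ∃[ ζ ] (Reach β x ζ × (∀ y → Reach β x y → ∣ γ ζ ∣ ≤ ∣ γ y ∣))
    smallest : ∀ f y → ∣ γ y ∣ ≤ f → Reach β x y → ¬ ¬ Least
    descend : ∀ f y → ∣ γ y ∣ < f → Reach β x y → ¬ ¬ Least
    smallest f y l r = do
      yes (y′ , r′ , l′) ← em {A = ∃[ y′ ] (Reach β x y′ × ∣ γ y′ ∣ < ∣ γ y ∣)}
        where no none → return (y , r , λ y′ r′ → ℕₚ.≮⇒≥ λ l′ → none (y′ , r′ , l′))
      descend f y′ (ℕₚ.≤-trans l′ l) r′
    descend (suc f) y (s≤s l) r = smallest f y l r

  module AtHub {β : Subset m} (β≤k : ∣ β ∣ ≤ k) {x : Point} (hub : Hub β x) where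
    open Hub hub

    spokeEnd : ∀ z → γ ζ ⊆ γ z → ∀ v → v ⊑ γ z → Point
    spokeEnd z sub v v⊑ = pt (base-walk ζ) (γ⊆α z) (γ≤k z) (⊑-++ (⊑-mono sub (word⊑ ζ)) v⊑)

    -- The point z is the hub moved by an element of ⟨β ∩ γ z⟩, all within one coset at the base of
    -- ζ. The inclusion `hub⊆` makes the word of ζ available in that coset.
    record Spoke (z : Point) : Set where
      field
        hub⊆ : γ ζ ⊆ γ z
        arm : Word m
        arm⊑β : arm ⊑ β
        arm⊑γ : arm ⊑ γ z
        at : spokeEnd z hub⊆ arm arm⊑γ ~ z

    -- Otherwise `common` gives a point of the component over the strictly smaller set γ ζ ∩ γ y.
    minimal-⊆ : ∀ {x y} → x ~ y → γ x ≡ γ ζ → Reach β ζ x → γ ζ ⊆ γ y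
    minimal-⊆ {x} {y} xy refl r = decidable-stable (γ ζ Subₚ.⊆? γ y) λ ⊈ → (do
      z , z~x , γz ← common xy
      return (ℕₚ.<⇒≱ (∩-< ⊈) (subst (λ δ → ∣ γ ζ ∣ ≤ ∣ δ ∣) γz
        (minimal (reach-trans r (reach-refl (~sym z~x))))))) id

    -- Being a spoke depends on the set γ z of the representative, hence the quantification over all
    -- z ~ y.
    Spoked : Point → Set
    Spoked y = ∀ z → z ~ y → ¬ ¬ Spoke z

    spoked-hub : Spoked ζ
    spoked-hub z z~ζ = return (record
      { hub⊆ = minimal-⊆ (~sym z~ζ) refl (reach-refl ~refl)
      ; arm = [] ; arm⊑β = [] ; arm⊑γ = []
      ; at = ~trans (same-base refl (Eq-reflexive (Listₚ.++-identityʳ (word ζ)))) (~sym z~ζ) })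

    -- The bases of ζ and z are joined by a walk u ≈ u₁ u₂ u₃, and h₁ · x̂ · k₃⁻¹ · u₂⁻¹ is a closed
    -- quadrilateral.  If k₃ splits, z lies in a coset of ⟨β ∩ γ q⟩, which is not narrow.  If x̂ splits,
    -- the splitting point has representations over γ ζ and over γ z, and minimality gives γ ζ ⊆ γ z.
    respoke : ∀ q (S : Spoke q) z → Reach β ζ z →
      spokeEnd q (Spoke.hub⊆ S) (Spoke.arm S) (Spoke.arm⊑γ S) ~ z → ¬ ¬ Spoke z
    respoke q S z reach-z X~z = do
      J@(u , v , r , a , b , j≈) ← joint X~z
      let k₂≈ , k₂⊑ = meet-word (~sym X~z) (v , u , r , b , a , Eq-sym j≈)
          k₂ = (inv v ++ word z) ↾ δ
          u≈ : u ≈′ word ζ ++ x̂ ++ inv k₂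
          u≈ = rewriting (u ∷ v ∷ word ζ ∷ x̂ ∷ k₂ ∷ base ζ ∷ base z ∷ word z ∷ []) v₀ (v₂ ⊕ v₃ ⊕ (⊖ v₄))
            (rw (⊖ v₅) (v₅ ⊕ v₀) (v₆ ⊕ v₁) j≈ ∷
             rw (⊖ v₅) (v₆ ⊕ v₇) (v₅ ⊕ v₂ ⊕ v₃) (Eq-sym (labels X~z)) ∷
             rw (v₂ ⊕ v₃ ⊕ (⊖ v₇) ⊕ v₁) v₄ ((⊖ v₁) ⊕ v₇) (Eq-sym k₂≈) ∷ []) refl
      u₁ , u₂ , u₃ , t₁ , t₂ , w₁ , w₂ , w₃ , u₁₂₃ ← convex′ {x₁ = word ζ} {x̂} {inv k₂} (γ≤k q) a
        hub⊆ βδ⊆δ (Subₚ.p∩q⊆q (γ z) δ) (word⊑ ζ) (⊑-∩ arm⊑β arm⊑γ) (⊑-inv k₂⊑) u≈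
      let h₁ = inv u₁ ++ word ζ
          k₃ = u₃ ++ k₂
          h₁⊑ : h₁ ⊑ γ ζ
          h₁⊑ = ⊑-++ (⊑-inv (walk-⊑ w₁)) (word⊑ ζ)
          k₃⊑ : k₃ ⊑ γ z ∩ δ
          k₃⊑ = ⊑-++ (walk-⊑ w₃) k₂⊑
          closed : h₁ ++ x̂ ++ inv k₃ ++ inv u₂ ≈′ []
          closed = Eq-trans (Eq-++ {u = h₁} Eq-refl (Eq-++ {u = x̂} Eq-refl (Eq-++ {v = inv u₂} (Eq-reflexive (inv-++ u₃ k₂)) Eq-refl)))
            (rewriting (u₁ ∷ u₂ ∷ u₃ ∷ u ∷ word ζ ∷ x̂ ∷ k₂ ∷ [])
              (((⊖ v₀) ⊕ v₄) ⊕ v₅ ⊕ ((⊖ v₆) ⊕ (⊖ v₂)) ⊕ (⊖ v₁)) ∅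
              (rw (⊖ v₀) (v₄ ⊕ v₅ ⊕ (⊖ v₆)) v₃ (Eq-sym u≈) ∷ rw (⊖ v₀) v₃ (v₀ ⊕ v₁ ⊕ v₂) u₁₂₃ ∷ []) refl)
      split ← four-cycle (γ≤k ζ) βδ≤k zδ≤k βδ≤k h₁⊑ (⊑-∩ arm⊑β arm⊑γ) (⊑-inv k₃⊑) (⊑-inv (walk-⊑ w₂)) closed
      let bw₁ = walk-++ (base-walk ζ) (walk-mono (γ⊆α ζ) w₁)
          bw₂ = walk-++ bw₁ (walk-mono (λ e∈ → γ⊆α q (βδ⊆δ e∈)) w₂)
      case split of λ where
        (inj₂ (c , c′ , c⊑ , cz⊑ , c′z⊑ , c′⊑ , k₃⁻¹≈)) →
          let κ⊑ : inv (c ++ c′) ⊑ β ∩ δ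
              κ⊑ = ⊑-inv (⊑-++ c⊑ c′⊑)
              k₃≈ : k₃ ≈′ inv (c ++ c′)
              k₃≈ = Eq-trans (Eq-reflexive (sym (inv-inv k₃)))
                (Eq-inv (up zδ≤k (⊑-inv k₃⊑) (⊑-++ cz⊑ c′z⊑) k₃⁻¹≈))
              V : Point
              V = pt bw₂ (λ e∈ → γ⊆α q (βδ⊆δ e∈)) βδ≤k κ⊑
              V₂ : Point
              V₂ = pt bw₂ (λ e∈ → γ⊆α q (zδ⊆δ e∈)) zδ≤k k₃⊑
              V₂~z : V₂ ~ z
              V₂~z = rewriting (u₁ ∷ u₂ ∷ u₃ ∷ u ∷ k₂ ∷ base ζ ∷ base z ∷ word z ∷ v ∷ [])
                  (((v₅ ⊕ v₀) ⊕ v₁) ⊕ (v₂ ⊕ v₄)) (v₆ ⊕ v₇)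
                  (rw v₅ (v₀ ⊕ v₁ ⊕ v₂) v₃ (Eq-sym u₁₂₃) ∷ rw ∅ (v₅ ⊕ v₃) (v₆ ⊕ v₈) j≈ ∷
                   rw (v₆ ⊕ v₈) v₄ ((⊖ v₈) ⊕ v₇) (Eq-sym k₂≈) ∷ []) refl
                with-joint return (u₃ , v , r , w₃ , b ,
                  rewriting (u₁ ∷ u₂ ∷ u₃ ∷ u ∷ base ζ ∷ base z ∷ v ∷ [])
                    (((v₄ ⊕ v₀) ⊕ v₁) ⊕ v₂) (v₅ ⊕ v₆)
                    (rw v₄ (v₀ ⊕ v₁ ⊕ v₂) v₃ (Eq-sym u₁₂₃) ∷ rw ∅ (v₄ ⊕ v₃) (v₅ ⊕ v₆) j≈ ∷ []) refl)
              V~V₂ : V ~ V₂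
              V~V₂ = same-base refl (Eq-sym k₃≈)
              e , e∈α , e∉β = proper-witness β≤k
          in ⊥-elim (e∉β (narrow (reach-trans reach-z (reach-refl (~sym (~trans V~V₂ V₂~z)))) e∈α
               (λ e∈ → e∉β (Subₚ.p∩q⊆p β δ e∈))))
        (inj₁ (x₁ , x₂ , x₁⊑ζ , x₁⊑ , x₂⊑ , x₂⊑z , x̂≈)) → do
          let x̂≈′ : x̂ ≈′ x₁ ++ x₂
              x̂≈′ = up βδ≤k (⊑-∩ arm⊑β arm⊑γ) (⊑-++ x₁⊑ x₂⊑) x̂≈
              W₀ : Point
              W₀ = pt bw₁ (γ⊆α ζ) (γ≤k ζ) h₁⊑
              W₁ : Point
              W₁ = extend W₀ x₁ x₁⊑ζ
              W₂ : Point
              W₂ = pt bw₂ (λ e∈ → γ⊆α q (zδ⊆δ e∈)) zδ≤k (⊑-++ k₃⊑ (⊑-inv x₂⊑z))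
              ζ~W₀ : ζ ~ W₀
              ζ~W₀ = rewriting (base ζ ∷ u₁ ∷ word ζ ∷ []) (v₀ ⊕ v₂) ((v₀ ⊕ v₁) ⊕ ((⊖ v₁) ⊕ v₂)) [] refl
                with-joint return (u₁ , [] , t₁ , w₁ , nil , Eq-reflexive (sym (Listₚ.++-identityʳ _)))
              reach-W₁ : Reach β ζ W₁
              reach-W₁ = reach-trans (reach-refl ζ~W₀) (x₁ , ⊑-∩ˡ x₁⊑ , word-path W₀ x₁ x₁⊑ζ)
              u₂≈ : u₂ ≈′ (h₁ ++ x₁) ++ (x₂ ++ inv k₃)
              u₂≈ = rewriting (h₁ ∷ x̂ ∷ k₃ ∷ u₂ ∷ x₁ ∷ x₂ ∷ []) v₃ ((v₀ ⊕ v₄) ⊕ (v₅ ⊕ (⊖ v₂)))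
                (rw ∅ ∅ (v₀ ⊕ v₁ ⊕ (⊖ v₂) ⊕ (⊖ v₃)) (Eq-sym closed) ∷ rw v₀ v₁ (v₄ ⊕ v₅) x̂≈′ ∷ []) refl
          z₁ , z₂ , t′ , d₁ , d₂ , z₁₂ ← convex₂ {x₁ = h₁ ++ x₁} {x₂ ++ inv k₃} (γ≤k q) (walk-mono βδ⊆δ w₂)
            hub⊆ zδ⊆δ (⊑-++ h₁⊑ x₁⊑ζ) (⊑-++ x₂⊑z (⊑-inv k₃⊑)) u₂≈
          let W₁~W₂ : W₁ ~ W₂
              W₁~W₂ = rewriting (base ζ ∷ u₁ ∷ u₂ ∷ h₁ ∷ k₃ ∷ x₁ ∷ x₂ ∷ [])
                  ((v₀ ⊕ v₁) ⊕ (v₃ ⊕ v₅)) (((v₀ ⊕ v₁) ⊕ v₂) ⊕ (v₄ ⊕ (⊖ v₆)))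
                  (rw (v₀ ⊕ v₁) ((v₃ ⊕ v₅) ⊕ (v₆ ⊕ (⊖ v₄))) v₂ (Eq-sym u₂≈) ∷ []) refl
                with-joint return (z₁ , inv z₂ , t′ , d₁ , walk-inv d₂ ,
                  rewriting (base ζ ∷ u₁ ∷ u₂ ∷ z₁ ∷ z₂ ∷ []) ((v₀ ⊕ v₁) ⊕ v₃) (((v₀ ⊕ v₁) ⊕ v₂) ⊕ (⊖ v₄))
                    (rw (v₀ ⊕ v₁) (v₃ ⊕ v₄) v₂ (Eq-sym z₁₂) ∷ []) refl)
              ζ⊆z : γ ζ ⊆ γ z
              ζ⊆z = λ e∈ → Subₚ.p∩q⊆p (γ z) δ (minimal-⊆ W₁~W₂ refl reach-W₁ e∈)
          return (record
            { hub⊆ = ζ⊆z ; arm = x₁ ++ x₂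
            ; arm⊑β = ⊑-++ (⊑-∩ˡ x₁⊑) (⊑-∩ˡ x₂⊑)
            ; arm⊑γ = ⊑-++ (⊑-mono ζ⊆z x₁⊑ζ) (⊑-∩ˡ x₂⊑z)
            ; at = ~trans (same-base refl (Eq-++ {u = word ζ} Eq-refl (Eq-sym x̂≈′))) X~z })
      where
      open Spoke S renaming (arm to x̂)
      δ : Subset m
      δ = γ q
      βδ⊆δ : β ∩ δ ⊆ δ
      βδ⊆δ = Subₚ.p∩q⊆q β δ
      βδ≤k : ∣ β ∩ δ ∣ ≤ k
      βδ≤k = ℕₚ.≤-trans (Subₚ.∣p∩q∣≤∣p∣ β δ) β≤k
      zδ≤k : ∣ γ z ∩ δ ∣ ≤ k
      zδ≤k = ℕₚ.≤-trans (Subₚ.∣p∩q∣≤∣p∣ (γ z) δ) (γ≤k z)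
      zδ⊆δ : γ z ∩ δ ⊆ δ
      zδ⊆δ = Subₚ.p∩q⊆q (γ z) δ

    spoked-move : ∀ {e y y′} → e ∈ β → Move e y y′ → Reach β ζ y → Spoked y → Spoked y′
    spoked-move {e} {y} {y′} e∈β mv@(q , e∈γ , y~q , qe~y′) reach-y spoked z z~y′ = do
      S ← spoked q (~sym y~q)
      let open Spoke S
          S′ : Spoke (snoc q e∈γ)
          S′ = record
            { hub⊆ = hub⊆ ; arm = arm ++ e ∷ []
            ; arm⊑β = ⊑-++ arm⊑β (e∈β ∷ []) ; arm⊑γ = ⊑-++ arm⊑γ (e∈γ ∷ [])
            ; at = ~trans (same-base refl (Eq-reflexive (sym (Listₚ.++-assoc (word ζ) arm _)))) (~snoc e∈γ e∈γ at) }
      respoke (snoc q e∈γ) S′ z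
        (reach-trans reach-y (reach-trans (reach-move e∈β mv) (reach-refl (~sym z~y′))))
        (~trans (Spoke.at S′) (~trans qe~y′ (~sym z~y′)))

    spoked-reach : ∀ {y} → Reach β ζ y → Spoked y
    spoked-reach (w , w⊑β , p) = proj₂ (path-invariant (λ y → Reach β ζ y × Spoked y)
      (λ { y~y′ (r , s) → reach-trans r (reach-refl y~y′) , λ z z~y′ → s z (~trans z~y′ (~sym y~y′)) })
      (λ { e∈β mv (r , s) → reach-trans r (reach-move e∈β mv) , spoked-move e∈β mv r s })
      w⊑β p (reach-refl ~refl , spoked-hub))

    spoke : ∀ {y} → Reach β x y → ¬ ¬ Spoke y
    spoke {y} r = spoked-reach (reach-trans (reach-sym reach-ζ) r) y ~refl

    -- By `same-base` the arm alone determines the point. Narrowness puts a letter of β outside γ y,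
    -- so the arm lies in a subgroup on at most j letters and has a representative of level j.
    hub-bounded : ∀ j → ∣ β ∣ ≡ suc j → Bounded (reps {m} (bd j)) β x
    hub-bounded j β≡ = record { Names = Names ; names-functional = functional ; named = named }
      where
      Names : Fin (reps {m} (bd j)) → Point → Set
      Names c y = ∃[ z ] (y ~ z × base z ≡ base ζ × word z ≡ word ζ ++ rep (bd j) c)
      functional : ∀ {c y z} → Names c y → Names c z → y ~ z
      functional (a , p , b≡ , w≡) (a′ , p′ , b≡′ , w≡′) =
        ~trans p (~trans (same-base (trans b≡ (sym b≡′)) (Eq-reflexive (trans w≡ (sym w≡′)))) (~sym p′))
      named : ∀ {y} → Reach β x y → ¬ ¬ (∃[ c ] Names c y)
      named {y} r = do
        S ← spoke r
        let open Spoke S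
            e , e∈α , e∉γ = proper-witness (γ≤k y)
            e∈β = narrow (reach-trans (reach-sym reach-ζ) r) e∈α e∉γ
            βγ≤j : ∣ β ∩ γ y ∣ ≤ j
            βγ≤j = ℕₚ.≤-pred (subst (∣ β ∩ γ y ∣ <_) β≡ (∩-< λ β⊆γ → e∉γ (β⊆γ e∈β)))
            j≤k : j ≤ k
            j≤k = ℕₚ.<⇒≤ (subst (_≤ k) β≡ β≤k)
            c , c⊑ , c≈ = short-rep bd (bd j) j (⊑-∩ arm⊑β arm⊑γ)
            c≈′ : rep (bd j) c ≈′ arm
            c≈′ = up (ℕₚ.≤-trans βγ≤j j≤k) c⊑ (⊑-∩ arm⊑β arm⊑γ)
              (Eq-up j≤k βγ≤j c⊑ (⊑-∩ arm⊑β arm⊑γ) c≈)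
        return (c , spokeEnd y hub⊆ (rep (bd j) c) (⊑-∩ʳ c⊑) ,
          ~trans (~sym at) (same-base refl (Eq-++ {u = word ζ} Eq-refl (Eq-sym c≈′))) , refl , refl)

  completion-local : ∀ β → β ⊆ α → ∣ β ∣ ≤ k → ∀ x → ¬ ¬ (Free k β x ⊎ Bounded (bd ∣ β ∣) β x)
  completion-local β β⊆α β≤k x = do
    inj₂ hub ← dichotomy β⊆α x
      where inj₁ (y , r , β⊆γ) → return (inj₁ (free-transport r (free-wide y β≤k β⊆γ)))
    return (inj₂ (bounded-at ∣ β ∣ refl hub))
    where
    bounded-at : ∀ j → ∣ β ∣ ≡ j → Hub β x → Bounded (bd j) β x
    bounded-at zero β≡ hub with proper-witness (γ≤k (Hub.ζ hub))
    ... | e , e∈α , e∉γ = ⊥-elim (ℕₚ.n≮0 (subst (∣ β ∩ γ (Hub.ζ hub) ∣ <_) β≡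
      (∩-< λ β⊆γ → e∉γ (β⊆γ (Hub.narrow hub (reach-refl ~refl) e∈α e∉γ)))))
    bounded-at (suc j) β≡ hub =
      widen (ℕₚ.≤-trans (reps≤mid j) (mid≤bd j)) (AtHub.hub-bounded β≤k hub j β≡)

  completion-admissible : Transfer.GraphAdmissible bd completion (suc k)
  completion-admissible = local-admissible {α = α} (λ { (z , e∈ , _) → γ⊆α z e∈ }) completion-local

  n≤mid : n ≤ mid k
  n≤mid = ℕₚ.≤-trans n≤bd (ℕₚ.≤-trans (bd-≤ {0} {k} z≤n) (bd≤mid k))

  -- The graph I is among the assignments of degree at most `mid k`, so prefixes acting alike end in
  -- the same state and the cut word is still a walk to t.
  short-walk : ∀ {p t} → Walk α s₀ p t → ∃[ r ] (Walk α s₀ (rep (mid k) r) t × rep (mid k) r ≈′ p)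
  short-walk {p} {t} w with shorten (mid k) (λ p → Walk α s₀ p t) cut p w
    where
    cut : ∀ u z r → SameUpTo (mid k) u (u ++ z) → Walk α s₀ (u ++ z ++ r) t → Walk α s₀ (u ++ r) t
    cut u z r u~uz w with walk-split u w
    ... | a , wu , wzr with walk-split z wzr
    ...   | b , wz , wr = walk-++ wu (subst (λ c → Walk α c r t) b≡a wr)
      where
      b≡a : b ≡ a
      b≡a = trans (sym (walk-end (walk-++ wu wz))) (trans (sym (u~uz n n≤mid π s₀)) (walk-end wu))
  ... | p′ , short , p′~p , w′ with nthWord-surjective (codes {m} (mid k)) p′ short
  ...   | r , refl = r , w′ , sameUpTo⇒Eq bd p′~p

  completion-bounded : ∀ x → Bounded (reps {m} (mid k) * reps {m} (mid k)) ⊤ x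
  completion-bounded x = record
    { Names = Names
    ; names-functional = λ {c} {y} {z} → functional (remQuot {K} K c) {y} {z}
    ; named = λ {y} _ → named y }
    where
    K : ℕ
    K = reps {m} (mid k)
    NameOf : Fin K × Fin K → Point → Set
    NameOf (a , b) y = ∃[ z ] (y ~ z × base z ≡ rep (mid k) a × word z ≡ rep (mid k) b)
    Names : Fin (K * K) → Point → Set
    Names c = NameOf (remQuot {K} K c)
    functional : ∀ c {y z} → NameOf c y → NameOf c z → y ~ z
    functional _ (_ , p , b≡ , w≡) (_ , p′ , b≡′ , w≡′) =
      ~trans p (~trans (same-base (trans b≡ (sym b≡′)) (Eq-reflexive (trans w≡ (sym w≡′)))) (~sym p′))
    named : ∀ y → ¬ ¬ (∃[ c ] Names c y)
    named y = return (combine (proj₁ a) (proj₁ b) ,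
      subst (λ c → NameOf c y) (sym (Finₚ.remQuot-combine (proj₁ a) (proj₁ b))) (z , y~z , refl , refl))
      where
      a = short-walk (base-walk y)
      b = short-rep bd (mid k) (suc k) (word⊑ y)
      z : Point
      z = pt (proj₁ (proj₂ a)) (γ⊆α y) (γ≤k y) (proj₁ (proj₂ b))
      y~z : y ~ z
      y~z = Eq-++ (Eq-sym (proj₂ (proj₂ a))) (Eq-sym (proj₂ (proj₂ b)))
        with-joint return ([] , [] , state y , nil , nil ,
          Eq-++ (Eq-sym (proj₂ (proj₂ a))) Eq-refl)

  root : ∀ {p t} → Walk α s₀ p t → Point
  root w = pt w (λ e∈⊥ → ⊥-elim (Subₚ.∉⊥ e∈⊥)) (subst (_≤ k) (sym (Subₚ.∣⊥∣≡0 m)) z≤n) {word = []} []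

  -- A step along e is taken inside the attached coset of ⟨e⟩, whose end is identified with the next
  -- base; singletons are small because 1 ≤ k.
  walk-path : 1 ≤ k → ∀ {p t u t′} (w : Walk α s₀ p t) (w′ : Walk α t u t′) →
    Path u (root w) (root (walk-++ w w′))
  walk-path 1≤k {p} w nil = same-base (sym (Listₚ.++-identityʳ p)) Eq-refl
  walk-path 1≤k {p} {t} w (cons {e = e} {s' = t₁} {w = u} e∈ r w′) =
    root w₁ , inj₁ (x , Subₚ.x∈⁅x⁆ e , same-base refl Eq-refl , arrive) ,
    path-respʳ u (same-base (Listₚ.++-assoc p (e ∷ []) u) Eq-refl) (walk-path 1≤k w₁ w′)
    where
    w₁ = walk-++ w (cons e∈ r nil)
    x : Point
    x = pt w (λ e′∈ → subst (_∈ α) (sym (Subₚ.x∈⁅y⁆⇒x≡y e e′∈)) e∈)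
      (subst (_≤ k) (sym (Subₚ.∣⁅x⁆∣≡1 e)) 1≤k) {word = []} []
    arrive : snoc x (Subₚ.x∈⁅x⁆ e) ~ root w₁
    arrive = Eq-reflexive (sym (Listₚ.++-identityʳ _)) with-joint return (e ∷ [] , [] , t₁ ,
      cons (Subₚ.x∈⁅x⁆ e) r nil , nil , Eq-reflexive (sym (Listₚ.++-identityʳ _)))

  -- Both words lead from the root to the same point, so ξ, at the end of x₁, and ω, just before x₃,
  -- lie in one γ₂-component. If some attached coset of ⟨τ⟩ with γ₂ ⊆ τ covers it, convexity of τ
  -- divides the walk between its joints with the outer cosets. Otherwise ξ and ω are spokes, and
  -- the walk can be led through the base of the hub with an empty middle part.
  convex-here : 1 ≤ k → ∀ {t u γ₁ γ₂ γ₃ x₁ x₂ x₃} → Walk α s₀ u t → γ₁ ⊆ α → γ₂ ⊆ α → γ₃ ⊆ α →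
    ∣ γ₁ ∣ ≤ k → ∣ γ₂ ∣ ≤ k → ∣ γ₃ ∣ ≤ k → x₁ ⊑ γ₁ → x₂ ⊑ γ₂ → x₃ ⊑ γ₃ →
    Eq (bd (suc k)) (suc k) u (x₁ ++ x₂ ++ x₃) → ¬ ¬ Walks₃ _≈′_ γ₁ γ₂ γ₃ s₀ u t
  convex-here 1≤k {t} {u} {γ₁} {γ₂} {γ₃} {x₁} {x₂} {x₃} w γ₁⊆ γ₂⊆ γ₃⊆ s₁ s₂ s₃ p₁ p₂ p₃ u≈ = do
    y , y-path ← path-total x₂ ξ
    y₃ , y₃-path ← path-total x₃ y
    let y₃~end = Transfer.transfer bd completion completion-admissible (root nil) Names names-functional
          (λ {v} p → named (v , ⊑-⊤ v , p)) (Eq-sym u≈)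
          (path-++ x₁ ξ-path (path-++ x₂ y-path y₃-path)) (walk-path 1≤k nil w)
        y~ω : y ~ ω
        y~ω = path-functional (inv x₃) (path-inv x₃ y₃-path)
          (path-respˡ (inv x₃) (~trans (same-base refl Eq-refl) (~sym y₃~end)) (word-path ω₀ (inv x₃) (⊑-inv p₃)))
        ξω : Path x₂ ξ ω
        ξω = path-respʳ x₂ y~ω y-path
    cases ← dichotomy γ₂⊆ ξ
    case cases of λ where
      (inj₁ (z , (v , v⊑ , vp) , γ₂⊆z)) → do
        let τ = γ z
            v⊑τ = ⊑-mono γ₂⊆z (⊑-inv v⊑)
            x₂⊑τ = ⊑-mono γ₂⊆z p₂
            A₁ = extend z (inv v) v⊑τ
            A₂ = extend A₁ x₂ x₂⊑τ
            A₁~ξ : A₁ ~ ξ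
            A₁~ξ = path-functional (inv v) (word-path z (inv v) v⊑τ) (path-inv v vp)
            A₂~ω : A₂ ~ ω
            A₂~ω = path-functional x₂ (word-path A₁ x₂ x₂⊑τ) (path-respˡ x₂ (~sym A₁~ξ) ξω)
        a′ , a , r , wa′ , wa , a≈ ← joint A₁~ξ
        b , b′ , r′ , wb , wb′ , b≈ ← joint A₂~ω
        let μ = inv a′ ++ b
            y₁ = inv a ++ x₁
            y₃ = x₃ ++ b′
            μ≈ : μ ≈′ y₁ ++ x₂ ++ y₃
            μ≈ = rewriting (a′ ∷ a ∷ b ∷ b′ ∷ x₁ ∷ x₂ ∷ x₃ ∷ u ∷ base z ∷ [])
              ((⊖ v₀) ⊕ v₂) (((⊖ v₁) ⊕ v₄) ⊕ v₅ ⊕ (v₆ ⊕ v₃))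
              (rw ((⊖ v₀) ⊕ (⊖ v₈)) (v₈ ⊕ v₂) (v₇ ⊕ v₃) b≈ ∷
               rw ((⊖ v₀) ⊕ (⊖ v₈)) v₁ (v₈ ⊕ v₀) (Eq-sym a≈) ∷
               rw (⊖ v₁) v₇ (v₄ ⊕ v₅ ⊕ v₆) u≈′ ∷ []) refl
            wμ : Walk τ r μ r′
            wμ = walk-++ (walk-inv wa′) wb
            μ≈τ : μ ≈′ y₁ ↾ τ ++ x₂ ++ y₃ ↾ τ
            μ≈τ = Eq-trans (Eq-reflexive (sym (↾-id (walk-⊑ wμ)))) (Eq-trans (Eq-↾ (suc k) τ μ≈)
              (Eq-reflexive (trans (↾-++ y₁ (x₂ ++ y₃) τ)
                (cong (y₁ ↾ τ ++_) (trans (↾-++ x₂ y₃ τ) (cong (_++ y₃ ↾ τ) (↾-id x₂⊑τ)))))))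
        u₁ , u₂ , u₃ , t₁ , t₂ , w₁ , w₂ , w₃ , μ₁₂₃ ← convex′ (γ≤k z) wμ
          (Subₚ.p∩q⊆q γ₁ τ) γ₂⊆z (Subₚ.p∩q⊆q γ₃ τ)
          (⊑-∩ (↾-keeps τ (⊑-++ (⊑-inv (walk-⊑ wa)) p₁)) (↾-⊑ y₁ τ)) p₂
          (⊑-∩ (↾-keeps τ (⊑-++ p₃ (walk-⊑ wb′))) (↾-⊑ y₃ τ)) μ≈τ
        return (a ++ u₁ , u₂ , u₃ ++ inv b′ , t₁ , t₂ ,
          walk-++ wa (walk-mono (Subₚ.p∩q⊆p γ₁ τ) w₁) , w₂ ,
          walk-++ (walk-mono (Subₚ.p∩q⊆p γ₃ τ) w₃) (walk-inv wb′) ,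
          rewriting (a′ ∷ a ∷ b ∷ b′ ∷ u ∷ base z ∷ u₁ ∷ u₂ ∷ u₃ ∷ [])
            v₄ ((v₁ ⊕ v₆) ⊕ v₇ ⊕ (v₈ ⊕ (⊖ v₃)))
            (rw ∅ (v₄ ⊕ v₃) (v₅ ⊕ v₂) (Eq-sym b≈) ∷ rw ∅ (v₅ ⊕ v₀) v₁ a≈ ∷
             rw v₁ ((⊖ v₀) ⊕ v₂) (v₆ ⊕ v₇ ⊕ v₈) μ₁₂₃ ∷ []) refl)
      (inj₂ hub) → do
        let open AtHub s₂ hub
            open Hub hub using (ζ)
        S₁ ← spoke (reach-refl ~refl)
        S₃ ← spoke (x₂ , p₂ , ξω)
        a , a′ , r , wa , wa′ , a≈ ← joint (Spoke.at S₁)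
        b , b′ , r′ , wb , wb′ , b≈ ← joint (Spoke.at S₃)
        return (a′ ++ inv a , [] , b ++ inv b′ , state ζ , state ζ ,
          walk-++ wa′ (walk-inv wa) , nil , walk-++ wb (walk-inv wb′) ,
          rewriting (a ∷ a′ ∷ b ∷ b′ ∷ u ∷ base ζ ∷ []) v₄ ((v₁ ⊕ (⊖ v₀)) ⊕ ∅ ⊕ (v₂ ⊕ (⊖ v₃)))
            (rw ∅ (v₄ ⊕ v₃) (v₅ ⊕ v₂) (Eq-sym b≈) ∷ rw ∅ (v₅ ⊕ v₀) v₁ a≈ ∷ []) refl)
    where
    ξ₀ ξ ω₀ ω : Point
    ξ₀ = pt nil γ₁⊆ s₁ {word = []} []
    ξ = extend ξ₀ x₁ p₁
    ω₀ = pt w γ₃⊆ s₃ {word = []} []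
    ω = extend ω₀ (inv x₃) (⊑-inv p₃)
    ξ-path : Path x₁ (root nil) ξ
    ξ-path = path-respˡ x₁ (same-base {ξ₀} {root nil} refl Eq-refl) (word-path ξ₀ x₁ p₁)
    u≈′ : u ≈′ x₁ ++ x₂ ++ x₃
    u≈′ = Eq-≤ (mid≤bd k) u≈
    open Bounded (widen (pairs≤bd k) (completion-bounded (root nil)))

-- Convexity of walk cosets at all levels

module Convexity {m n N : ℕ} (growth : Growth m N) (I : EGraph m n) (n≤bd : n ≤ Growth.bd growth 0) where
  open Growth growth
  open Tower {m} bd
  open Monotone bd-mono
  open EGraph I hiding (sym)
  open Walks I

  no-letters : ∀ {w : Word m} {γ} → ∣ γ ∣ ≤ 0 → w ⊑ γ → w ≡ []
  no-letters γ≤0 [] = refl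
  no-letters {e ∷ _} {γ} γ≤0 (e∈ ∷ _) = ⊥-elim (ℕₚ.n≮0 (ℕₚ.≤-trans (subst (_≤ ∣ γ ∣) (Subₚ.∣⁅x⁆∣≡1 e)
    (Subₚ.p⊆q⇒∣p∣≤∣q∣ λ e′∈ → subst (_∈ γ) (sym (Subₚ.x∈⁅y⁆⇒x≡y e e′∈)) e∈)) γ≤0))

  convex-step : ∀ k α → ∣ α ∣ ≡ suc k → (∀ δ → ∣ δ ∣ ≤ k → Convex growth I k δ) → Convex growth I (suc k) α
  convex-step k α α≡ convex {s} {t} {u} {γ₁} {γ₂} {γ₃} {x₁} {x₂} {x₃} w γ₁⊆ γ₂⊆ γ₃⊆ p₁ p₂ p₃ u≈
    with α Subₚ.⊆? γ₁ | α Subₚ.⊆? γ₂ | α Subₚ.⊆? γ₃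
  ... | yes α⊆ | _ | _ = return (u , [] , [] , t , t , walk-mono α⊆ w , nil , nil ,
    Eq-reflexive (sym (Listₚ.++-identityʳ u)))
  ... | no _ | yes α⊆ | _ = return ([] , u , [] , s , t , nil , walk-mono α⊆ w , nil ,
    Eq-reflexive (sym (Listₚ.++-identityʳ u)))
  ... | no _ | no _ | yes α⊆ = return ([] , [] , u , s , s , nil , nil , walk-mono α⊆ w , Eq-refl)
  ... | no n₁ | no n₂ | no n₃ = proper k α≡ convex u≈
    where
    small : ∀ {k γ} → ∣ α ∣ ≡ suc k → γ ⊆ α → ¬ (α ⊆ γ) → ∣ γ ∣ ≤ k
    small {γ = γ} α≡ γ⊆α α⊈γ = ℕₚ.≤-pred (subst (∣ γ ∣ <_) α≡ (Subₚ.p⊂q⇒∣p∣<∣q∣ (γ⊆α , ⊈-witness α⊈γ)))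
    proper : ∀ k → ∣ α ∣ ≡ suc k → (∀ δ → ∣ δ ∣ ≤ k → Convex growth I k δ) →
      Eq (bd (suc k)) (suc k) u (x₁ ++ x₂ ++ x₃) → ¬ ¬ Walks₃ (Eq (bd (suc k)) (suc k)) γ₁ γ₂ γ₃ s u t
    -- Here α is a single letter and no coset of ⟨e⟩ is attached. The proper subsets are empty, u is
    -- trivial in the group, and so its walk is closed in I.
    proper zero α≡ convex u≈ = return (trivial
      (no-letters (small α≡ γ₁⊆ n₁) p₁) (no-letters (small α≡ γ₂⊆ n₂) p₂) (no-letters (small α≡ γ₃⊆ n₃) p₃))
      where
      trivial : x₁ ≡ [] → x₂ ≡ [] → x₃ ≡ [] → Walks₃ (Eq (bd 1) 1) γ₁ γ₂ γ₃ s u t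
      trivial refl refl refl = [] , [] , [] , s , s , nil , nil , subst (Walk γ₃ s []) s≡t nil , u≈
        where
        s≡t : s ≡ t
        s≡t = trans (sym (Eq-small-graph (bd-mono 0) u≈ π n≤bd π-involutive s)) (walk-end w)
    proper (suc k) α≡ convex u≈ = do
      u₁ , u₂ , u₃ , t₁ , t₂ , w₁ , w₂ , w₃ , u₁₂₃ ← Completion.convex-here growth I n≤bd (suc k) α α≡ convex s
        (s≤s z≤n) w γ₁⊆ γ₂⊆ γ₃⊆ s₁ s₂ s₃ p₁ p₂ p₃ u≈
      -- The two factorisations of u agree so far only modulo `mid`. Their quotient, up to
      -- conjugation, is this product of four small elements.
      let closed : (inv u₁ ++ x₁) ++ x₂ ++ (x₃ ++ inv u₃) ++ inv u₂ ≋ []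
          closed = four-product _ s₁ s₂ s₃ s₂ (⊑-++ (⊑-inv (walk-⊑ w₁)) p₁) p₂
            (⊑-++ p₃ (⊑-inv (walk-⊑ w₃))) (⊑-inv (walk-⊑ w₂))
            (S′.rewriting (u ∷ x₁ ∷ x₂ ∷ x₃ ∷ u₁ ∷ u₂ ∷ u₃ ∷ [])
              (((⊖ v₄) ⊕ v₁) ⊕ v₂ ⊕ (v₃ ⊕ (⊖ v₆)) ⊕ (⊖ v₅)) ∅
              (S′.rw (⊖ v₄) (v₁ ⊕ v₂ ⊕ v₃) v₀ (Eq-sym (Eq-≤ (mid≤bd (suc k)) u≈)) ∷
               S′.rw (⊖ v₄) v₀ (v₄ ⊕ v₅ ⊕ v₆) u₁₂₃ ∷ []) refl)
      return (u₁ , u₂ , u₃ , t₁ , t₂ , w₁ , w₂ , w₃ ,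
        rewriting (u ∷ x₁ ∷ x₂ ∷ x₃ ∷ u₁ ∷ u₂ ∷ u₃ ∷ []) v₀ (v₄ ⊕ v₅ ⊕ v₆)
          (rw ∅ v₀ (v₁ ⊕ v₂ ⊕ v₃) u≈ ∷
           rw v₄ (((⊖ v₄) ⊕ v₁) ⊕ v₂ ⊕ (v₃ ⊕ (⊖ v₆)) ⊕ (⊖ v₅)) ∅ closed ∷ []) refl)
      where
      open SmallProducts growth (suc k) using (four-product)
      open GroupSolver (Eq-group (bd (suc (suc k))) (suc (suc k)))
      module S′ = GroupSolver (Eq-group (mid (suc k)) (suc (suc k)))
      _≋_ : Word m → Word m → Set
      _≋_ = Eq (bd (suc (suc k))) (suc (suc k))
      infix 4 _≋_
      s₁ = small α≡ γ₁⊆ n₁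
      s₂ = small α≡ γ₂⊆ n₂
      s₃ = small α≡ γ₃⊆ n₃

  convex-all : ∀ k α → ∣ α ∣ ≤ k → Convex growth I k α
  convex-all zero α α≤0 nil _ _ _ _ _ _ _ =
    return ([] , [] , [] , _ , _ , nil , nil , nil , Eq-refl)
  convex-all zero α α≤0 (cons e∈ r w) _ _ _ _ _ _ _ with no-letters α≤0 (walk-⊑ (cons e∈ r w))
  ... | ()
  convex-all (suc k) α α≤ w γ₁⊆ γ₂⊆ γ₃⊆ p₁ p₂ p₃ u≈ with ℕₚ.m≤n⇒m<n∨m≡n α≤
  ... | inj₂ α≡ = convex-step k α α≡ (convex-all k) w γ₁⊆ γ₂⊆ γ₃⊆ p₁ p₂ p₃ u≈
  ... | inj₁ (s≤s α≤k) = do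
    u₁ , u₂ , u₃ , t₁ , t₂ , w₁ , w₂ , w₃ , u₁₂₃ ← convex-all k α α≤k w γ₁⊆ γ₂⊆ γ₃⊆ p₁ p₂ p₃
      (Eq-down₁ k (bd-mono k) u≈)
    return (u₁ , u₂ , u₃ , t₁ , t₂ , w₁ , w₂ , w₃ , Eq-up₁ (bd (suc k)) α≤k (walk-⊑ w)
      (⊑-++ (⊑-mono γ₁⊆ (walk-⊑ w₁)) (⊑-++ (⊑-mono γ₂⊆ (walk-⊑ w₂)) (⊑-mono γ₃⊆ (walk-⊑ w₃)))) u₁₂₃)

-- The cover

image : ∀ {a b} → (Fin a → Fin b) → Subset a → Subset b
image f [] = ⊥
image f (inside ∷ β) = ⁅ f zero ⁆ ∪ image (f ∘ suc) β
image f (outside ∷ β) = image (f ∘ suc) β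

∣∪∣≤ : ∀ {a} (p q : Subset a) → ∣ p ∪ q ∣ ≤ ∣ p ∣ + ∣ q ∣
∣∪∣≤ [] [] = z≤n
∣∪∣≤ (outside ∷ p) (outside ∷ q) = ∣∪∣≤ p q
∣∪∣≤ (outside ∷ p) (inside ∷ q) = ℕₚ.≤-trans (s≤s (∣∪∣≤ p q)) (ℕₚ.≤-reflexive (sym (ℕₚ.+-suc ∣ p ∣ ∣ q ∣)))
∣∪∣≤ (inside ∷ p) (outside ∷ q) = s≤s (∣∪∣≤ p q)
∣∪∣≤ (inside ∷ p) (inside ∷ q) =
  s≤s (ℕₚ.≤-trans (∣∪∣≤ p q) (ℕₚ.+-monoʳ-≤ ∣ p ∣ (ℕₚ.n≤1+n ∣ q ∣)))

∣image∣≤ : ∀ {a b} (f : Fin a → Fin b) β → ∣ image f β ∣ ≤ ∣ β ∣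
∣image∣≤ {b = b} f [] = ℕₚ.≤-reflexive (Subₚ.∣⊥∣≡0 b)
∣image∣≤ f (inside ∷ β) = ℕₚ.≤-trans (∣∪∣≤ ⁅ f zero ⁆ (image (f ∘ suc) β))
  (ℕₚ.+-mono-≤ (ℕₚ.≤-reflexive (Subₚ.∣⁅x⁆∣≡1 (f zero))) (∣image∣≤ (f ∘ suc) β))
∣image∣≤ f (outside ∷ β) = ∣image∣≤ (f ∘ suc) β

∈-image : ∀ {a b} (f : Fin a → Fin b) {β e} → e ∈ β → f e ∈ image f β
∈-image f {inside ∷ β} {zero} e∈ = Subₚ.x∈p∪q⁺ (inj₁ (Subₚ.x∈⁅x⁆ (f zero)))
∈-image f {inside ∷ β} {suc e} (there e∈) = Subₚ.x∈p∪q⁺ (inj₂ (∈-image (f ∘ suc) e∈))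
∈-image f {outside ∷ β} {suc e} (there e∈) = ∈-image (f ∘ suc) e∈

module Relabelling {m : ℕ} (bd : ℕ → ℕ) where
  open Tower {m} bd

  act-map : ∀ {M} (f : Fin m → Fin m) (σ : Letters m M) w x → act σ (map f w) x ≡ act (σ ∘ f) w x
  act-map f σ [] x = refl
  act-map f σ (e ∷ w) x = act-map f σ w (σ (f e) x)

  Small-map : ∀ {k} (f : Fin m → Fin m) {w} → Small k w → Small k (map f w)
  Small-map f (β , β≤k , w⊑β) = image f β , ℕₚ.≤-trans (∣image∣≤ f β) β≤k ,
    Allₚ.map⁺ (All.map (∈-image f) w⊑β)

  -- Renaming sends words over at most k letters to words over at most k letters, so an induction on
  -- the level applies: nothing in the levels refers to particular letters.
  admissible-map : ∀ k {M} (f : Fin m → Fin m) {σ : Letters m M} → Admissible k σ → Admissible k (σ ∘ f)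
  Eq-map : ∀ {M} k f {u v} → Eq M k u v → Eq M k (map f u) (map f v)

  admissible-map zero f a = tt
  admissible-map (suc k) f {σ} a w small w≈ x = trans (sym (act-map f σ w x))
    (a (map f w) (Small-map f small) (sameAction (Eq-map {bd k} k f {w} {[]} (eq w≈))) x)

  Eq-map k f {u} {v} p = eq λ M′ l σ i a x → trans (act-map f σ u x)
    (trans (sameAction p M′ l (σ ∘ f) (i ∘ f) (admissible-map k f a) x) (sym (act-map f σ v x)))

module GrowthExists (m N : ℕ) (4≤N : 4 ≤ N) (B : ℕ) where

  midOf bdOf : ℕ → ℕ
  midOf b = b + N * reps {m} b + reps {m} b
  bdOf b = midOf b + reps {m} (midOf b) * reps {m} (midOf b)

  bounds : ℕ → ℕ
  bounds zero = B
  bounds (suc k) = bdOf (bounds k)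

  growth : Growth m N
  growth = record
    { bd = bounds
    ; mid = midOf ∘ bounds
    ; bd≤mid = λ k → ℕₚ.≤-trans (ℕₚ.m≤m+n _ _) (ℕₚ.m≤m+n _ _)
    ; mid≤bd = λ k → ℕₚ.m≤m+n _ _
    ; pieces≤mid = λ k → ℕₚ.≤-trans (ℕₚ.m≤n+m _ (bounds k)) (ℕₚ.m≤m+n _ _)
    ; reps≤mid = λ k → ℕₚ.m≤n+m _ (bounds k + N * reps {m} (bounds k))
    ; pairs≤bd = λ k → ℕₚ.m≤n+m _ (midOf (bounds k))
    ; 4≤N = 4≤N }

-- The multiplication table of a finite group need not decide its equality, but it can be thinned
-- out until the generators act on the indices by involutions.
module Thinning {m : ℕ} {c ℓ} (G : EGroup m c ℓ) where
  open EGroup G renaming (refl to ≈-refl; sym to ≈-sym; trans to ≈-trans; reflexive to ≈-reflexive)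

  Enumerates : ∀ {k} → (Fin k → Carrier) → Set (c ⊔ˡ ℓ)
  Enumerates {k} f = ∀ g → ∃[ i ] (f i ≈ g)

  record Action : Set (c ⊔ˡ ℓ) where
    field
      size : ℕ
      point : Fin size → Carrier
      enumerates : Enumerates point
      σ : Letters m size
      σ-involutive : Involutive σ
      σ-point : ∀ e i → point (σ e i) ≈ point i ∙ ι e

  involutive : ∀ g e → (g ∙ ι e) ∙ ι e ≈ g
  involutive g e = ≈-trans (assoc _ _ _) (≈-trans (∙-congˡ (invol e)) (identityʳ g))

  -- If applying e twice moves an index i to some j ≠ i, then both enumerate the same element, since
  -- `ι e` is an involution. Dropping i keeps the enumeration complete and lowers k.
  thin : ∀ k (f : Fin k → Carrier) → Enumerates f → Action
  thin k f enum with Finₚ.any? (λ e → Finₚ.any? (λ i → ¬? (σ e (σ e i) Finₚ.≟ i)))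
    where
    σ : Letters m k
    σ e i = proj₁ (enum (f i ∙ ι e))
  ... | no none = record
    { size = k ; point = f ; enumerates = enum
    ; σ = λ e i → proj₁ (enum (f i ∙ ι e))
    ; σ-involutive = λ e i → decidable-stable (_ Finₚ.≟ i) λ ¬p → none (e , i , ¬p)
    ; σ-point = λ e i → proj₂ (enum (f i ∙ ι e)) }
  thin zero f enum | yes (_ , () , _)
  thin (suc k) f enum | yes (e , i , j≢i) = thin k (f ∘ punchIn i) enum′
    where
    j : Fin (suc k)
    j = proj₁ (enum (f (proj₁ (enum (f i ∙ ι e))) ∙ ι e))
    fj≈fi : f j ≈ f i
    fj≈fi = ≈-trans (proj₂ (enum _)) (≈-trans (∙-congʳ (proj₂ (enum _))) (involutive (f i) e))
    enum′ : Enumerates (f ∘ punchIn i)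
    enum′ g with enum g
    ... | a , fa≈g with i Finₚ.≟ a
    ...   | no i≢a = punchOut i≢a , ≈-trans (≈-reflexive (cong f (Finₚ.punchIn-punchOut i≢a))) fa≈g
    ...   | yes refl = punchOut (j≢i ∘ sym) ,
      ≈-trans (≈-reflexive (cong f (Finₚ.punchIn-punchOut (j≢i ∘ sym)))) (≈-trans fj≈fi fa≈g)

  module _ (A : Action) where
    open Action A

    act-point : ∀ w i → point (act σ w i) ≈ point i ∙ ⟦ w ⟧G
    act-point [] i = ≈-sym (identityʳ _)
    act-point (e ∷ w) i =
      ≈-trans (act-point w (σ e i)) (≈-trans (∙-congʳ (σ-point e i)) (assoc _ _ _))

    act-faithful : ∀ {u v} → (∀ i → act σ u i ≡ act σ v i) → ⟦ u ⟧G ≈ ⟦ v ⟧G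
    act-faithful {u} {v} p with enumerates ε
    ... | i , pi≈ε = ≈-trans (value u) (≈-trans (≈-reflexive (cong point (p i))) (≈-sym (value v)))
      where
      value : ∀ w → ⟦ w ⟧G ≈ point (act σ w i)
      value w = ≈-sym (≈-trans (act-point w i) (≈-trans (∙-congʳ pi≈ε) (identityˡ _)))

  eval-++ : ∀ u v → ⟦ u ++ v ⟧G ≈ ⟦ u ⟧G ∙ ⟦ v ⟧G
  eval-++ [] v = ≈-sym (identityˡ _)
  eval-++ (e ∷ u) v = ≈-trans (∙-congˡ (eval-++ u v)) (≈-sym (assoc _ _ _))

module UniversalCover {c ℓ : Level} {m n : ℕ} (I : EGraph m n) (G : EGroup m c ℓ)
  (A : Thinning.Action G) (N : ℕ) where
  open Thinning G using (act-faithful; eval-++)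
  open Thinning.Action A using (size; σ; σ-involutive)
  -- Degree size + n admits the action of G on itself and the graph I at every level; N + 4 admits
  -- cycles of length up to N and the four-sided chains.
  open GrowthExists m (N + 4) (ℕₚ.m≤n+m 4 N) (size + n) using (growth)
  open Growth growth
  open Tower {m} bd
  open Monotone bd-mono
  open EGraph I hiding (sym)
  open Walks I
  private module G = EGroup G

  infix 4 _≈_
  -- Level m is enough, as a proper set of letters has at most m - 1 elements and its subgroup no
  -- longer changes after that level.
  _≈_ : Word m → Word m → Set
  _≈_ = Eq (bd m) m

  n≤bd : n ≤ bd 0
  n≤bd = ℕₚ.m≤n+m n size

  ≈⇒≈G : ∀ {u v} → u ≈ v → G.⟦ u ⟧G G.≈ G.⟦ v ⟧G
  ≈⇒≈G {u} {v} p = act-faithful A {u} {v}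
    (Eq-small-graph (bd-≤ {0} {m} z≤n) p σ (ℕₚ.m≤m+n size n) σ-involutive)

  ĝroup : Group c ℓ
  ĝroup = record
    { Carrier = Lift c (Word m)
    ; _≈_ = λ u v → Lift ℓ (lower u ≈ lower v)
    ; _∙_ = λ u v → lift (lower u ++ lower v)
    ; ε = lift []
    ; _⁻¹ = λ u → lift (inv (lower u))
    ; isGroup = record
      { isMonoid = record
        { isSemigroup = record
          { isMagma = record
            { isEquivalence = record
              { refl = lift Eq-refl
              ; sym = λ p → lift (Eq-sym (lower p))
              ; trans = λ p q → lift (Eq-trans (lower p) (lower q)) }
            ; ∙-cong = λ p q → lift (Eq-++ (lower p) (lower q)) }
          ; assoc = λ u v w → lift (Eq-reflexive (Listₚ.++-assoc (lower u) (lower v) (lower w))) }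
        ; identity = (λ u → lift Eq-refl) , (λ u → lift (Eq-reflexive (Listₚ.++-identityʳ (lower u)))) }
      ; inverse = (λ u → lift (Eq-cancelˡ (lower u))) , (λ u → lift (Eq-cancelʳ (lower u)))
      ; ⁻¹-cong = λ p → lift (Eq-inv (lower p)) } }

  letter : Fin m → Lift c (Word m)
  letter e = lift (e ∷ [])

  eval : ∀ w → lower (evalWord ĝroup letter w) ≡ w
  eval [] = refl
  eval (e ∷ w) = cong (e ∷_) (eval w)

  letter-value : ∀ e → G.⟦ e ∷ [] ⟧G G.≈ G.ι e
  letter-value e = G.identityʳ (G.ι e)

  Ĝ : EGroup m c ℓ
  Ĝ = record
    { group = ĝroup
    ; ι = letter
    ; invol = λ e → lift (Eq-cancelʳ (e ∷ []))
    ; nontriv = λ e p → G.nontriv e (G.trans (G.sym (letter-value e)) (≈⇒≈G (lower p)))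
    ; distinct = λ e e′ p → G.distinct e e′
        (G.trans (G.sym (letter-value e)) (G.trans (≈⇒≈G (lower p)) (letter-value e′)))
    ; generates = λ g → lower g , lift (Eq-reflexive (sym (eval (lower g)))) }

  Ĝ-finite : FiniteEGroup Ĝ
  Ĝ-finite = reps {m} (bd m) , (λ r → lift (rep (bd m) r)) , λ g →
    let r , _ , p = short-rep bd (bd m) m (⊑-⊤ (lower g)) in r , lift p

  eval-inv : ∀ w → G.⟦ inv w ⟧G G.≈ G.⟦ w ⟧G G.⁻¹
  eval-inv w = inverseʳ-unique G.⟦ w ⟧G G.⟦ inv w ⟧G
    (G.trans (G.sym (eval-++ w (inv w))) (≈⇒≈G (Eq-cancelʳ w)))
    where open import Algebra.Properties.Group G.group using (inverseʳ-unique)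

  Ĝ⪰G : Ĝ ⪰ G
  Ĝ⪰G = (λ u → G.⟦ lower u ⟧G) , record
    { isMonoidHomomorphism = record
      { isMagmaHomomorphism = record
        { isRelHomomorphism = record { cong = λ p → ≈⇒≈G (lower p) }
        ; homo = λ u v → eval-++ (lower u) (lower v) }
      ; ε-homo = G.refl }
    ; ⁻¹-homo = λ u → eval-inv (lower u) } , letter-value

  act-π : ∀ w s → act π w s ≡ ⟦ w ⟧H s
  act-π [] s = refl
  act-π (e ∷ w) s = act-π w (π e s)

  Ĝ-compatible : Compatible Ĝ I
  Ĝ-compatible w w≈ε s = trans (sym (act-π w s)) (Eq-small-graph (bd-≤ {0} {m} z≤n)
    (subst (_≈ []) (eval w) (lower w≈ε)) π n≤bd π-involutive s)

  Ĝ-symmetric : ∀ ρ → GroupSymmetry Ĝ ρ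
  Ĝ-symmetric ρ = (λ u → lift (map to (lower u))) , record
    { isGroupMonomorphism = record
      { isGroupHomomorphism = record
        { isMonoidHomomorphism = record
          { isMagmaHomomorphism = record
            { isRelHomomorphism = record { cong = λ p → lift (Eq-map m to (lower p)) }
            ; homo = λ u v → lift (Eq-reflexive (Listₚ.map-++ to (lower u) (lower v))) }
          ; ε-homo = lift Eq-refl }
        ; ⁻¹-homo = λ u → lift (Eq-reflexive (map-inv (lower u))) }
      ; injective = λ {u} {v} p → lift (Eq-trans (Eq-reflexive (sym (from-to (lower u))))
          (Eq-trans (Eq-map m from (lower p)) (Eq-reflexive (from-to (lower v))))) }
    ; surjective = λ v → lift (map from (lower v)) , λ p →
        lift (Eq-trans (Eq-map m to (lower p)) (Eq-reflexive (to-from (lower v)))) } , λ e → lift Eq-refl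
    where
    open Relabelling {m} bd using (Eq-map)
    to from : Fin m → Fin m
    to = ρ ⟨$⟩ʳ_
    from = ρ ⟨$⟩ˡ_
    from-to : ∀ w → map from (map to w) ≡ w
    from-to w = trans (sym (Listₚ.map-∘ w)) (trans (Listₚ.map-cong (λ e → Perm.inverseˡ ρ) w) (Listₚ.map-id w))
    to-from : ∀ w → map to (map from w) ≡ w
    to-from w = trans (sym (Listₚ.map-∘ w)) (trans (Listₚ.map-cong (λ e → Perm.inverseʳ ρ) w) (Listₚ.map-id w))
    map-inv : ∀ w → map to (inv w) ≡ inv (map to w)
    map-inv [] = refl
    map-inv (e ∷ w) = trans (Listₚ.map-++ to (inv w) (e ∷ [])) (cong (_++ to e ∷ []) (map-inv w))

  module NoCycle (k : ℕ) (m≡ : m ≡ suc k) (j : ℕ) (j≤N : 2 + j ≤ N) (C : CosetCycle Ĝ I (2 + j)) where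
    open CosetCycle C
    L : ℕ
    L = 2 + j

    -- Chains are indexed by natural numbers; reading these modulo L unrolls the cycle.
    ix : ℕ → Fin L
    ix i = fromℕ< (m%n<n i L)

    ix-cong : ∀ a b → a % L ≡ b % L → ix a ≡ ix b
    ix-cong a b p = Finₚ.fromℕ<-cong (a % L) (b % L) p (m%n<n a L) (m%n<n b L)

    ix-shift : ∀ i b → ix (toℕ (ix i) + b) ≡ ix (i + b)
    ix-shift i b = ix-cong (toℕ (ix i) + b) (i + b)
      (trans (cong (λ a → (a + b) % L) (Finₚ.toℕ-fromℕ< (m%n<n i L)))
        (trans (%-distribˡ-+ (i % L) b L)
          (trans (cong (λ a → (a + b % L) % L) (m%n%n≡m%n i L)) (sym (%-distribˡ-+ i b L)))))

    csuc-ix : ∀ i → csuc (ix i) ≡ ix (suc i)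
    csuc-ix i = trans (ix-shift i 1) (cong ix (ℕₚ.+-comm i 1))

    cpred-ix : ∀ i → cpred (ix (suc i)) ≡ ix i
    cpred-ix i = trans (ix-shift (suc i) (suc j)) (trans (cong ix (sym (ℕₚ.+-suc i (suc j))))
      (ix-cong (i + L) i ([m+n]%n≡m%n i L)))

    γ : ℕ → Subset m
    γ i = α (ix i)

    w : ℕ → Word m
    w i = proj₁ (connectivity (ix i))

    walk : ∀ i → Walk (γ i) (s (ix i)) (w i) (s (csuc (ix i)))
    walk i = proj₁ (proj₂ (connectivity (ix i)))

    w⊑γ : ∀ i → w i ⊑ γ i
    w⊑γ i = walk-⊑ (walk i)

    connected : ∀ i → lower (g (csuc (ix i))) ≈ lower (g (ix i)) ++ w i
    connected i = Eq-trans (lower (proj₂ (proj₂ (connectivity (ix i)))))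
      (Eq-++ Eq-refl (Eq-reflexive (eval (w i))))

    γ≤k : ∀ i → ∣ γ i ∣ ≤ k
    γ≤k i = ℕₚ.≤-pred (subst (suc ∣ γ i ∣ ≤_) (trans (Subₚ.∣⊤∣≡n m) m≡)
      (Subₚ.p⊂q⇒∣p∣<∣q∣ (Subₚ.⊆⊤ , proj₁ (proper (ix i)) , Subₚ.∈⊤ , proj₂ (proper (ix i)))))

    k≤m : k ≤ m
    k≤m = subst (k ≤_) (sym m≡) (ℕₚ.n≤1+n k)

    travelled : ∀ i → lower (g (ix 0)) ++ prefixWord w i ≈ lower (g (ix i))
    travelled zero = Eq-reflexive (Listₚ.++-identityʳ _)
    travelled (suc i) = Eq-trans (Eq-reflexive (sym (Listₚ.++-assoc (lower (g (ix 0))) (prefixWord w i) (w i))))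
      (Eq-trans (Eq-++ (travelled i) Eq-refl)
        (Eq-trans (Eq-sym (connected i)) (Eq-reflexive (cong (lower ∘ g) (csuc-ix i)))))

    closed : prefixWord w L ≈ []
    closed = rewriting (lower (g (ix 0)) ∷ prefixWord w L ∷ []) v₁ ∅
      (rw (⊖ v₀) (v₀ ⊕ v₁) v₀ (Eq-trans (travelled L)
        (Eq-reflexive (cong (lower ∘ g) (ix-cong L 0 (n%n≡0 L))))) ∷ []) refl
      where open GroupSolver (Eq-group (bd m) m)

    private module Ch = Chain bd bd-mono mid (N + 4) mid≤bd pieces≤mid k γ γ≤k w w⊑γ

    unseparated : ¬ ¬ (∃[ i ] Ch.Unseparated i)
    unseparated = at-length j refl
      where
      closed′ : Eq (bd (suc k)) (suc k) (prefixWord w L) []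
      closed′ = subst (λ M → Eq (bd M) M (prefixWord w L) []) m≡ closed
      at-length : ∀ j′ → j ≡ j′ → ¬ ¬ (∃[ i ] Ch.Unseparated i)
      at-length (suc j′) refl = do
        i , _ , u ← Ch.cycle-unseparated L (s≤s (s≤s (s≤s z≤n))) (ℕₚ.≤-trans j≤N (ℕₚ.m≤m+n N 4))
          (Eq-≤ (mid≤bd k) closed′)
        return (i , u)
      -- In a cycle of length two both sides lie in both subgroups.
      at-length zero refl = return (0 , w 1 ↾ γ 0 , [] , ↾-⊑ (w 1) (γ 0) , ↾-keeps (γ 0) (w⊑γ 1) , [] , [] ,
        Eq-trans (Eq-meet w₁≈ (⊑-inv (w⊑γ 0))) (Eq-reflexive (sym (Listₚ.++-identityʳ _))))
        where
        open GroupSolver (Eq-group (bd k) k)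
        w₁≈ : Eq (bd k) k (w 1) (inv (w 0))
        w₁≈ = rewriting (w 0 ∷ w 1 ∷ []) v₁ (⊖ v₀)
          (rw (⊖ v₀) ((∅ ⊕ v₀) ⊕ v₁) ∅ (Eq-down₁ k (bd-mono k) closed′) ∷ []) refl

    -- Convexity turns the splitting of a side in Ĝ into one along walks of I.
    contradictory : ∀ i → Ch.Unseparated i → Empty
    contradictory i (v , v′ , v⊑γ₀ , v⊑γ₁ , v′⊑γ₁ , v′⊑γ₂ , w≈) = (do
      u₁ , u₂ , u₃ , t₁ , t₂ , w₁ , w₂ , w₃ , u≈ ← convex-all k (γ (suc i)) (γ≤k (suc i)) (walk (suc i))
        (Subₚ.p∩q⊆p (γ (suc i)) _) (Subₚ.p∩q⊆p (γ (suc i)) _) (Subₚ.p∩q⊆p (γ (suc i)) _)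
        (⊑-∩ v⊑γ₁ (subst (λ a → v ⊑ α a) (sym (cpred-ix i)) v⊑γ₀))
        (⊑-∩ v′⊑γ₁ (subst (λ a → v′ ⊑ α a) (sym (csuc-ix (suc i))) v′⊑γ₂)) []
        (Eq-trans w≈ (Eq-reflexive (cong (v ++_) (sym (Listₚ.++-identityʳ v′)))))
      let here = ix (suc i)
          w′ = walk-++ w₂ w₃
          side≈ : w (suc i) ≈ u₁ ++ u₂ ++ u₃
          side≈ = Eq-up k≤m (γ≤k (suc i)) (w⊑γ (suc i)) (⊑-++ (⊑-∩ˡ (walk-⊑ w₁)) (⊑-∩ˡ (walk-⊑ w′))) u≈
          x≈ : lower (g here) ++ u₁ ≈ lower (g (csuc here)) ++ inv (u₂ ++ u₃)
          x≈ = rewriting (lower (g here) ∷ lower (g (csuc here)) ∷ u₁ ∷ (u₂ ++ u₃) ∷ w (suc i) ∷ [])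
            (v₀ ⊕ v₂) (v₁ ⊕ (⊖ v₃))
            (rw v₀ (v₂ ⊕ v₃) v₄ (Eq-sym side≈) ∷ rw ∅ (v₀ ⊕ v₄) v₁ (Eq-sym (connected (suc i))) ∷ []) refl
      return (separation here (lift (lower (g here) ++ u₁) ,
        (u₁ , t₁ , w₁ , lift (Eq-++ Eq-refl (Eq-reflexive (sym (eval u₁))))) ,
        (inv (u₂ ++ u₃) , t₁ , walk-inv w′ ,
          lift (Eq-trans x≈ (Eq-++ Eq-refl (Eq-reflexive (sym (eval (inv (u₂ ++ u₃)))))))))))
      id
      where
      open Convexity growth I n≤bd using (convex-all)
      open GroupSolver (Eq-group (bd m) m)

    absurd : Empty
    absurd = (unseparated >>= λ { (i , u) → return (contradictory i u) }) id

  Ĝ-acyclic : Acyclic Ĝ I N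
  Ĝ-acyclic = Ĝ-compatible , λ j j≤N C → no-cycle m refl j j≤N C
    where
    no-cycle : ∀ k → m ≡ k → ∀ j → 2 + j ≤ N → ¬ CosetCycle Ĝ I (2 + j)
    no-cycle zero refl j j≤N C with proj₁ (CosetCycle.proper C zero)
    ... | ()
    no-cycle (suc k) m≡ j j≤N C = NoCycle.absurd k m≡ j j≤N C

theorem7p19 : ∀ {c ℓ : Level} (m n : ℕ) (I : EGraph m n) (G : EGroup m c ℓ) →
    FiniteEGroup G → Compatible G I → (N : ℕ) → 2 ≤ N →
    Σ (EGroup m c ℓ) λ Ĝ →
    FiniteEGroup Ĝ
    × Ĝ ⪰ G
    × Compatible Ĝ I
    × Acyclic Ĝ I N
    × (∀ (ρ : Permutation′ m) → GraphSymmetry I ρ → GroupSymmetry G ρ → GroupSymmetry Ĝ ρ)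
theorem7p19 m n I G (k , f , enumerates) _ N _ =
  Ĝ , Ĝ-finite , Ĝ⪰G , Ĝ-compatible , Ĝ-acyclic , λ ρ _ _ → Ĝ-symmetric ρ
  where open UniversalCover I G (Thinning.thin G k f enumerates) N
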